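{- Let $D$ be a directed graph, let $f : V(D) \to \mathbb{Z}_{\ge 2}$ be a function, and let $d = \max\{\Delta^-(D), \Delta^+_{f-1}(D)\}$. If $D$ has directed girth $g \ge 4d$, then $\vec{a}_f(D) \le d + 1$.
   Context: A directed graph has no loops and no parallel arcs (two arcs with the same tail and same head), but may have anti-parallel arcs. $\Delta^-(D)$ is the maximum indegree; $\Delta^+_{f-1}(D) = \max_{v \in V(D)} \lceil d^+(v)/(f(v)-1) \rceil$, where $d^+(v)$ is the outdegree. A branching is a directed graph in which every vertex has indegree at most $1$ and whose underlying undirected graph is a forest. A degree-$f$ branching of $D$ is a spanning subgraph $B$ of $D$ that is a branching in which every vertex $v$ has outdegree at most $f(v) - 1$. The directed degree-$f$ arboricity $\vec{a}_f(D)$ is the minimum number of colors in an arc-coloring of $D$ in which every color class is a degree-$f$ branching. The directed girth is the length of a shortest directed cycle (infinite if there is none). -}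

module Defs where

open import Data.Nat using (ℕ; zero; suc; _+_; _*_; _∸_; _≤_; _⊔_; _/_)
open import Data.Nat.Properties using ()
open import Data.Bool using (Bool; true; false; if_then_else_; _∧_)
open import Data.Fin using (Fin; zero; suc; inject₁; fromℕ)
open import Data.Fin.Properties using (_≟_)
open import Data.List using (List; map; foldr; allFin)
open import Data.Nat.ListAction using (sum)
open import Data.Empty using (⊥)
open import Data.Product using (Σ; _×_; _,_; ∃)
open import Data.Sum using (_⊎_)
open import Function.Definitions using (Injective)
open import Relation.Binary.PropositionalEquality using (_≡_; _≢_)
open import Relation.Nullary.Decidable using (⌊_⌋)

-- A (finite) directed graph on vertex set Fin n, given by its arc relation:
-- arc u v = true  iff  (u , v) is an arc.  Parallel arcs are impossible by
-- construction; anti-parallel arcs are allowed.  Loops are excluded by the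
-- Loopless predicate below.
Digraph : ℕ → Set
Digraph n = Fin n → Fin n → Bool

Loopless : ∀ {n} → Digraph n → Set
Loopless {n} D = (v : Fin n) → D v v ≡ false

countV : ∀ {n} → (Fin n → Bool) → ℕ
countV {n} p = sum (map (λ u → if p u then 1 else 0) (allFin n))

indeg : ∀ {n} → Digraph n → Fin n → ℕ
indeg D v = countV (λ u → D u v)

outdeg : ∀ {n} → Digraph n → Fin n → ℕ
outdeg D v = countV (λ u → D v u)

maxV : ∀ {n} → (Fin n → ℕ) → ℕ
maxV {n} h = foldr _⊔_ 0 (map h (allFin n))

ceilDivSuc : ℕ → ℕ → ℕ
ceilDivSuc a m = (a + m) / suc m

Δ⁻ : ∀ {n} → Digraph n → ℕ
Δ⁻ D = maxV (indeg D)

-- Δ⁺_{f-1}(D) = max_v ⌈ d⁺(v) / (f(v) - 1) ⌉.  Since f(v) ≥ 2 we have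
-- f(v) - 1 = suc (f(v) ∸ 2).
Δ⁺[f-1] : ∀ {n} → Digraph n → (Fin n → ℕ) → ℕ
Δ⁺[f-1] D f = maxV (λ v → ceilDivSuc (outdeg D v) (f v ∸ 2))

IsDirCycle : ∀ {n} → Digraph n → (k : ℕ) → (Fin (suc k) → Fin n) → Set
IsDirCycle D k vs =
  Injective _≡_ _≡_ vs ×
  ((i : Fin k) → D (vs (inject₁ i)) (vs (suc i)) ≡ true) ×
  (D (vs (fromℕ k)) (vs zero) ≡ true)

-- directed girth ≥ g : every directed cycle has length at least g
-- (vacuous if there is no directed cycle, i.e. girth = ∞)
DirGirth≥ : ∀ {n} → Digraph n → ℕ → Set
DirGirth≥ D g = ∀ k vs → IsDirCycle D k vs → g ≤ suc k

Adj : ∀ {n} → Digraph n → Fin n → Fin n → Set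
Adj D u v = (D u v ≡ true) ⊎ (D v u ≡ true)

-- A cycle in the underlying undirected multigraph of D: either a pair of
-- anti-parallel arcs (a cycle of length 2 formed by two distinct parallel
-- edges), or distinct vertices vs 0, …, vs (suc (suc k)) (length ≥ 3) with
-- consecutive ones (cyclically) adjacent.
HasUndirCycle : ∀ {n} → Digraph n → Set
HasUndirCycle {n} D =
  (Σ (Fin n) λ u → Σ (Fin n) λ v → u ≢ v × D u v ≡ true × D v u ≡ true) ⊎
  (Σ ℕ λ k → Σ (Fin (suc (suc (suc k))) → Fin n) λ vs →
     Injective _≡_ _≡_ vs ×
     ((i : Fin (suc (suc k))) → Adj D (vs (inject₁ i)) (vs (suc i))) ×
     Adj D (vs (fromℕ (suc (suc k)))) (vs zero))

IsForest : ∀ {n} → Digraph n → Set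
IsForest D = HasUndirCycle D → ⊥

IsDegreeFBranching : ∀ {n} → (Fin n → ℕ) → Digraph n → Set
IsDegreeFBranching {n} f B =
  ((v : Fin n) → indeg B v ≤ 1) ×
  IsForest B ×
  ((v : Fin n) → outdeg B v ≤ f v ∸ 1)

-- An arc-colouring with m colours is a map c on pairs of vertices (its values
-- on non-arcs are irrelevant).  Colour class i as a spanning subgraph of D:
ColourClass : ∀ {n m} → Digraph n → (Fin n → Fin n → Fin m) → Fin m → Digraph n
ColourClass D c i u v = D u v ∧ ⌊ c u v ≟ i ⌋

DirDegFArboricity≤ : ∀ {n} → Digraph n → (Fin n → ℕ) → ℕ → Set
DirDegFArboricity≤ {n} D f m =
  Σ (Fin n → Fin n → Fin m) λ c →
    (i : Fin m) → IsDegreeFBranching f (ColourClass D c i)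

{-# OPTIONS --safe #-}
-- By König's theorem on the split graph (each tail u divided into f(u) − 1
-- copies of degree ≤ d) the arcs get d colours, each class having indegrees
-- ≤ 1 and outdegrees ≤ f − 1; such a class fails to be a branching only through
-- its directed cycles, all of length ≥ 4d.  One arc of every monochromatic cycle
-- is moved to a new colour, so that the moved arcs have in- and outdegrees ≤ 1
-- and span no directed cycle.  These arcs are found by a local search in the
-- manner of Haxell's theorem on independent transversals.  To serve a cycle not
-- yet represented in the selection M, one stacks arcs x₁, x₂, …, where x blocks
-- the selected arcs with the same head, the same tail, and the arc at which the
-- path of M through x would close up.  Each further x is taken from a cycle that
-- is unrepresented or represented by a blocked arc, and must not interfere with
-- the arcs stacked or blocked so far: w blocked arcs exclude at most 4dw arcs,
-- while the w + 1 cycles in question contain 4d(w + 1).  If x blocks nothing it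
-- replaces the representative of its cycle, which either serves the new cycle or
-- decreases the number of arcs blocked by an earlier x.
module Submission where

open import Defs
open import Level using (0ℓ)
open import Data.Nat using (ℕ; zero; suc; _+_; _*_; _∸_; _⊔_; _/_; _%_; _≤_; _<_; _<?_; z≤n; s≤s)
open import Data.Nat.DivMod using (m<n*o⇒m/o<n; m%n<n; m≡m%n+[m/n]*n; m*n/n≡m; /-monoˡ-≤)
open import Data.Nat.GeneralisedArithmetic using (fold; fold-+)
open import Data.Nat.Induction using (<-wellFounded)
open import Data.Nat.ListAction using (sum)
open import Data.Nat.Properties
open import Data.Bool using (Bool; true; false; if_then_else_)
open import Data.Bool.Properties using () renaming (_≟_ to _≟ᵇ_)
open import Data.Empty using (⊥)
open import Data.Fin using (Fin; zero; suc; toℕ; inject₁; fromℕ) renaming (_<_ to _<ᶠ_)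
open import Data.Fin.Induction using (<-weakInduction; >-weakInduction)
open import Data.Fin.Properties as Fin
  using (pigeonhole; toℕ<n; toℕ-fromℕ; toℕ-inject₁; toℕ-injective; toℕ≤pred[n]; inject₁-injective; fromℕ≢inject₁)
  renaming (_≟_ to _≟ᶠ_; _<?_ to _<ᶠ?_; <-cmp to <ᶠ-cmp; <-trans to <ᶠ-trans; <-irrefl to <ᶠ-irrefl)
open import Data.Fin.Relation.Unary.Top using (view; ‵fromℕ; ‵inject₁)
open import Data.List using (List; []; _∷_; _++_; length; map; filter; foldr; concatMap; allFin; lookup; upTo; cartesianProduct)
open import Data.List.Properties using (length-++; length-map; length-filter; filter-notAll; length-tabulate; length-upTo)
open import Data.List.Membership.Propositional using (_∈_; find; lose)
open import Data.List.Membership.Propositional.Properties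
  using (∈-∃++; ∈-++⁺ˡ; ∈-++⁺ʳ; ∈-++⁻; ∈-map⁻; ∈-filter⁺; ∈-filter⁻; ∈-concatMap⁺; ∈-allFin;
         ∈-cartesianProduct⁺; ∈-upTo⁺; ∈-upTo⁻; ∈-lookup)
open import Data.List.Relation.Unary.All as All using (All; []; _∷_)
open import Data.List.Relation.Unary.All.Properties using (¬Any⇒All¬; All¬⇒¬Any)
open import Data.List.Relation.Unary.AllPairs using ([]; _∷_)
open import Data.List.Relation.Unary.Any as Any using (Any; here; there; any?; index)
open import Data.List.Relation.Unary.Any.Properties using (lookup-index)
open import Data.List.Relation.Unary.Unique.Propositional using (Unique)
open import Data.List.Relation.Unary.Unique.Propositional.Properties
  using (map⁺; ++⁺; filter⁺; allFin⁺; upTo⁺; cartesianProduct⁺)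
open import Data.Maybe using (Maybe; just; nothing)
open import Data.Maybe.Properties using (just-injective) renaming (≡-dec to ≡-decᵐ)
open import Data.Product using (Σ; ∃; ∃₂; _×_; _,_; proj₁; proj₂)
open import Data.Product.Properties using (≡-dec)
open import Data.Sum using (_⊎_; inj₁; inj₂)
open import Data.Unit.Polymorphic using (⊤; tt)
open import Function using (_∘_; id)
open import Induction.WellFounded using (Acc; acc; WellFounded)
open import Relation.Binary as Binary using (Rel; DecidableEquality; tri<; tri≈; tri>)
open import Relation.Binary.PropositionalEquality
open import Relation.Nullary using (¬_; Dec; yes; no; contradiction; ¬?; _×-dec_; _⊎-dec_; decidable-stable)
open import Relation.Nullary.Decidable using (map′)
open import Relation.Unary using (Decidable)

-- Lists

private
  variable
    A B : Set

-- Nearly all counting below goes through this injection principle. Injectivity is asked for on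
-- members of `xs` only, since the maps used are injective only there.
length-inj : (g : A → B) {xs : List A} {ys : List B} → Unique xs →
  (∀ {x y} → x ∈ xs → y ∈ xs → g x ≡ g y → x ≡ y) →
  (∀ {x} → x ∈ xs → g x ∈ ys) → length xs ≤ length ys
length-inj g {[]} xs! inj sub = z≤n
length-inj g {x ∷ xs} (x∉ ∷ xs!) inj sub
  with as , bs , refl ← ∈-∃++ (sub (here refl)) = begin
    suc (length xs)                 ≤⟨ s≤s (length-inj g xs! (λ p q → inj (there p) (there q)) sub′) ⟩
    suc (length (as ++ bs))         ≡⟨ cong suc (length-++ as) ⟩
    suc (length as + length bs)     ≡⟨ +-suc (length as) (length bs) ⟨
    length as + suc (length bs)     ≡⟨ length-++ as ⟨
    length (as ++ g x ∷ bs)         ∎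
  where
  open ≤-Reasoning
  sub′ : ∀ {z} → z ∈ xs → g z ∈ as ++ bs
  sub′ z∈ with ∈-++⁻ as (sub (there z∈))
  ... | inj₁ p = ∈-++⁺ˡ p
  ... | inj₂ (there p) = ∈-++⁺ʳ as p
  ... | inj₂ (here gz≡gx) =
    contradiction (inj (here refl) (there z∈) (sym gz≡gx)) (All.lookup x∉ z∈)

length-⊆ : {xs ys : List A} → Unique xs → (∀ {x} → x ∈ xs → x ∈ ys) → length xs ≤ length ys
length-⊆ xs! = length-inj id xs! (λ _ _ → id)

length-concatMap≤ : ∀ (f : A → List B) N xs → (∀ {x} → x ∈ xs → length (f x) ≤ N) →
  length (concatMap f xs) ≤ length xs * N
length-concatMap≤ f N [] le = z≤n
length-concatMap≤ f N (x ∷ xs) le = ≤-trans (≤-reflexive (length-++ (f x)))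
  (+-mono-≤ (le (here refl)) (length-concatMap≤ f N xs (le ∘ there)))

-- Local search for an acyclic transversal

module Exchange
  {V E : Set} (_≟ᵛ_ : DecidableEquality V) (_≟ᵉ_ : DecidableEquality E)
  (src tgt : E → V) (_~_ : Rel E 0ℓ) (_~?_ : Binary.Decidable _~_)
  (items : List E) (items! : Unique items)
  (~-refl : ∀ {e} → e ~ e) (~-trans : ∀ {a b c} → a ~ b → b ~ c → a ~ c)
  (~-sym : ∀ {a b} → a ∈ items → a ~ b → b ~ a)
  (loopless : ∀ {e} → e ∈ items → src e ≢ tgt e)
  (simple : ∀ {a b} → a ∈ items → b ∈ items → src a ≡ src b → tgt a ≡ tgt b → a ≡ b)
  (d : ℕ)
  (src-degree : ∀ v → length (filter (λ e → src e ≟ᵛ v) items) ≤ d)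
  (tgt-degree : ∀ v → length (filter (λ e → tgt e ≟ᵛ v) items) ≤ d)
  (class-large : ∀ {e} → e ∈ items → 4 * d ≤ length (filter (_~? e) items))
  where

  -- The argument order makes accessibility of `z` say that every walk leaving `z` terminates, so
  -- that `wf` below excludes directed cycles in the selection.
  Arc : (E → Set) → V → V → Set
  Arc P z′ z = ∃ λ e → P e × src e ≡ z × tgt e ≡ z′

  record Selection : Set₁ where
    field
      In : E → Set
      in? : Decidable In
      In⊆items : ∀ {e} → In e → e ∈ items
      src-inj : ∀ {a b} → In a → In b → src a ≡ src b → a ≡ b
      tgt-inj : ∀ {a b} → In a → In b → tgt a ≡ tgt b → a ≡ b
      ~-inj : ∀ {a b} → In a → In b → a ~ b → a ≡ b
      wf : WellFounded (Arc In)

  open Selection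

  data Path (W : E → Set) (v : V) : V → Set where
    nil : Path W v v
    snoc : ∀ {e} → Path W v (src e) → W e → Path W v (tgt e)

  Path-map : ∀ {W W′ : E → Set} {v z} → (∀ {e} → W e → W′ e) → Path W v z → Path W′ v z
  Path-map f nil = nil
  Path-map f (snoc p w) = snoc (Path-map f p) (f w)

  -- Traced backwards, a path is forced at each step because targets in `W` are distinct, and it can
  -- halt only at a vertex that no edge of `W` enters.
  Path-start-unique : ∀ {W : E → Set} {v v′ z z′} →
    (∀ {a b} → W a → W b → tgt a ≡ tgt b → a ≡ b) →
    (∀ {w} → W w → tgt w ≢ v) → (∀ {w} → W w → tgt w ≢ v′) →
    Path W v z → Path W v′ z′ → z ≡ z′ → v ≡ v′
  Path-start-unique inj ¬v ¬v′ nil nil eq = eq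
  Path-start-unique inj ¬v ¬v′ nil (snoc q w) eq = contradiction (sym eq) (¬v w)
  Path-start-unique inj ¬v ¬v′ (snoc p w) nil eq = contradiction eq (¬v′ w)
  Path-start-unique inj ¬v ¬v′ (snoc p w) (snoc q w′) eq =
    Path-start-unique inj ¬v ¬v′ p q (cong src (inj w w′ eq))

  -- Here y is the vertex at which the path from tgt x along edges claimed by
  -- earlier frames leaves those edges.  Removing the selected edge that leaves y,
  -- rather than an edge next to x, is what keeps the count of obstacles at 4d.
  Touch : E → V → E → Set
  Touch x y e = tgt e ≡ tgt x ⊎ src e ≡ src x ⊎ src e ≡ y

  touch? : ∀ x y → Decidable (Touch x y)
  touch? x y e = (tgt e ≟ᵛ tgt x) ⊎-dec (src e ≟ᵛ src x) ⊎-dec (src e ≟ᵛ y)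

  record Frame : Set where
    constructor frame
    field
      edge : E
      halt : V
      bound : ℕ

  open Frame

  Touched : List Frame → E → Set
  Touched frs e = Any (λ fr → Touch (edge fr) (halt fr) e) frs

  touched? : ∀ frs → Decidable (Touched frs)
  touched? frs e = any? (λ fr → touch? (edge fr) (halt fr) e) frs

  Claim : Selection → E → V → E → Set
  Claim M x y e = In M e × Touch x y e

  claims : Selection → E → V → List E
  claims M x y = filter (λ e → in? M e ×-dec touch? x y e) items

  Hit : Selection → List Frame → E → Set
  Hit M frs e = In M e × Touched frs e

  hits : Selection → List Frame → List E
  hits M frs = filter (λ e → in? M e ×-dec touched? frs e) items

  ∈-claims⁺ : ∀ M {x y e} → Claim M x y e → e ∈ claims M x y
  ∈-claims⁺ M {x} {y} c = ∈-filter⁺ (λ e → in? M e ×-dec touch? x y e) (In⊆items M (proj₁ c)) c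

  ∈-claims⁻ : ∀ M {x y e} → e ∈ claims M x y → Claim M x y e
  ∈-claims⁻ M {x} {y} e∈ = proj₂ (∈-filter⁻ (λ e → in? M e ×-dec touch? x y e) {xs = items} e∈)

  ∈-hits⁺ : ∀ M {frs e} → Hit M frs e → e ∈ hits M frs
  ∈-hits⁺ M {frs} c = ∈-filter⁺ (λ e → in? M e ×-dec touched? frs e) (In⊆items M (proj₁ c)) c

  ∈-hits⁻ : ∀ M {frs e} → e ∈ hits M frs → Hit M frs e
  ∈-hits⁻ M {frs} e∈ = proj₂ (∈-filter⁻ (λ e → in? M e ×-dec touched? frs e) {xs = items} e∈)

  claims! : ∀ M x y → Unique (claims M x y)
  claims! M x y = filter⁺ (λ e → in? M e ×-dec touch? x y e) items!

  hits! : ∀ M frs → Unique (hits M frs)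
  hits! M frs = filter⁺ (λ e → in? M e ×-dec touched? frs e) items!

  srcItems tgtItems : V → List E
  srcItems v = filter (λ e → src e ≟ᵛ v) items
  tgtItems v = filter (λ e → tgt e ≟ᵛ v) items

  ∈-srcItems : ∀ {e v} → e ∈ items → src e ≡ v → e ∈ srcItems v
  ∈-srcItems {v = v} = ∈-filter⁺ (λ e → src e ≟ᵛ v)

  ∈-tgtItems : ∀ {e v} → e ∈ items → tgt e ≡ v → e ∈ tgtItems v
  ∈-tgtItems {v = v} = ∈-filter⁺ (λ e → tgt e ≟ᵛ v)

  module _ (M : Selection) {x y} (x∈ : x ∈ items)
           (path : Path (In M) (tgt x) y) (y≢src : y ≢ src x)
           (unclaimed : ∀ {e} → ¬ Claim M x y e) where

    private
      In′ : E → Set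
      In′ e = e ≡ x ⊎ (In M e × ¬ (e ~ x))

      acc-stop : Acc (Arc In′) y
      acc-stop = acc λ where
        (_ , inj₁ refl , s , _) → contradiction (sym s) y≢src
        (_ , inj₂ (m , _) , s , _) → contradiction (m , inj₂ (inj₂ s)) unclaimed

      -- Distinct sources leave each vertex of the path a single exit, so accessibility spreads back
      -- from `y` to `tgt x`. Hence adding `x` closes no cycle.
      acc-back : ∀ {v z} → Path (In M) v z → Acc (Arc In′) z → Acc (Arc In′) v
      acc-back nil a = a
      acc-back (snoc p m) a = acc-back p (acc λ where
        (_ , inj₁ refl , s , _) → contradiction (m , inj₂ (inj₁ (sym s))) unclaimed
        (_ , inj₂ (m′ , _) , s , refl) →
          subst (Acc (Arc In′)) (cong tgt (src-inj M m m′ (sym s))) a)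

      acc-all : ∀ {z} → Acc (Arc (In M)) z → Acc (Arc In′) z
      acc-all (acc rs) = acc λ where
        (_ , inj₁ refl , _ , refl) → acc-back path acc-stop
        (e , inj₂ (m , _) , s , t) → acc-all (rs (e , m , s , t))

    exchange : Selection
    exchange .In = In′
    exchange .in? e = (e ≟ᵉ x) ⊎-dec (in? M e ×-dec ¬? (e ~? x))
    exchange .In⊆items (inj₁ refl) = x∈
    exchange .In⊆items (inj₂ (m , _)) = In⊆items M m
    exchange .src-inj (inj₁ refl) (inj₁ refl) _ = refl
    exchange .src-inj (inj₁ refl) (inj₂ (m , _)) s = contradiction (m , inj₂ (inj₁ (sym s))) unclaimed
    exchange .src-inj (inj₂ (m , _)) (inj₁ refl) s = contradiction (m , inj₂ (inj₁ s)) unclaimed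
    exchange .src-inj (inj₂ (m , _)) (inj₂ (m′ , _)) s = src-inj M m m′ s
    exchange .tgt-inj (inj₁ refl) (inj₁ refl) _ = refl
    exchange .tgt-inj (inj₁ refl) (inj₂ (m , _)) s = contradiction (m , inj₁ (sym s)) unclaimed
    exchange .tgt-inj (inj₂ (m , _)) (inj₁ refl) s = contradiction (m , inj₁ s) unclaimed
    exchange .tgt-inj (inj₂ (m , _)) (inj₂ (m′ , _)) s = tgt-inj M m m′ s
    exchange .~-inj (inj₁ refl) (inj₁ refl) _ = refl
    exchange .~-inj (inj₁ refl) (inj₂ (m , ≁)) s = contradiction (~-sym x∈ s) ≁
    exchange .~-inj (inj₂ (m , ≁)) (inj₁ refl) s = contradiction s ≁
    exchange .~-inj (inj₂ (m , _)) (inj₂ (m′ , _)) s = ~-inj M m m′ s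
    exchange .wf z = acc-all (wf M z)

  -- Stacks of blocked edges and their unwinding

  module _ (a : E) (a∈ : a ∈ items) (M₀ : Selection) where

    Covers : Selection → Set
    Covers M = ∀ {e} → In M₀ e → ∃ λ e′ → In M e′ × e′ ~ e

    Augmentation : Set₁
    Augmentation = Σ Selection λ M → (∃ λ e → In M e × e ~ a) × Covers M

    -- The path runs through hits of earlier frames rather than all of `M`, so that the record
    -- survives every exchange leaving those hits alone. `fresh-tgt`, `fresh-src` and `stops` keep
    -- the claims of `x` disjoint from the earlier hits.
    record Fits (M : Selection) (frs : List Frame) (x : E) (y : V) : Set where
      field
        x∈ : x ∈ items
        key : x ~ a ⊎ ∃ λ w → Hit M frs w × x ~ w
        avoids : All (λ fr → ¬ Touch (edge fr) (halt fr) x) frs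
        fresh-tgt : ∀ {w} → Hit M frs w → tgt w ≢ tgt x
        fresh-src : ∀ {w} → Hit M frs w → src w ≢ src x
        path : Path (Hit M frs) (tgt x) y
        stops : ∀ {w} → Hit M frs w → src w ≢ y
        open-end : y ≢ src x

    -- The bounds, most recent frame first, are what the recursion descends on:
    -- lexicographically, with the oldest frame most significant.
    data Stack (M : Selection) : List Frame → Set where
      base : (∀ {e} → In M e → ¬ (e ~ a)) → Covers M → Stack M []
      push : ∀ {frs x y b} → Stack M frs → Fits M frs x y → ∃ (Claim M x y) →
        length (claims M x y) ≤ b → Stack M (frame x y b ∷ frs)

    -- One continuation per frame, resumed when an exchange has lowered the claims of that frame
    -- below its bound and the frames beneath still form a stack. This turns the lexicographic
    -- descent into structural recursion.
    Handler : List Frame → Set₁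
    Handler [] = ⊤
    Handler (frame x y b ∷ frs) =
      (∀ M → Stack M frs → Fits M frs x y → length (claims M x y) < b → Augmentation) × Handler frs

    Fits-resp : ∀ {M M′ frs x y} → (∀ {e} → Hit M frs e → Hit M′ frs e) →
      (∀ {e} → Hit M′ frs e → Hit M frs e) → Fits M frs x y → Fits M′ frs x y
    Fits-resp to from F = record
      { x∈ = x∈ ; key = key′ key ; avoids = avoids
      ; fresh-tgt = fresh-tgt ∘ from ; fresh-src = fresh-src ∘ from
      ; path = Path-map to path ; stops = stops ∘ from ; open-end = open-end }
      where
      open Fits F
      key′ : _ → _
      key′ (inj₁ p) = inj₁ p
      key′ (inj₂ (w , h , p)) = inj₂ (w , to h , p)

    disjoint : ∀ {M frs x y e} → Fits M frs x y → Claim M x y e → ¬ Hit M frs e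
    disjoint F (_ , inj₁ t) h = Fits.fresh-tgt F h t
    disjoint F (_ , inj₂ (inj₁ s)) h = Fits.fresh-src F h s
    disjoint F (_ , inj₂ (inj₂ s)) h = Fits.stops F h s

    -- Each frame has a claim, which by `disjoint` is no hit of the frames beneath it, so every
    -- frame contributes a new hit.
    depth≤hits : ∀ {M frs} → Stack M frs → length frs ≤ length (hits M frs)
    depth≤hits (base _ _) = z≤n
    depth≤hits {M} {fr ∷ frs} (push S F (e , c) _) = ≤-trans (s≤s (depth≤hits S))
      (length-⊆ (¬Any⇒All¬ _ (λ e∈ → disjoint F c (∈-hits⁻ M e∈)) ∷ hits! M frs) sub)
      where
      sub : ∀ {z} → z ∈ e ∷ hits M frs → z ∈ hits M (fr ∷ frs)
      sub (here refl) = ∈-hits⁺ M (proj₁ c , here (proj₂ c))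
      sub (there z∈) with m , t ← ∈-hits⁻ M z∈ = ∈-hits⁺ M (m , there t)

    module _ {M frs x y} (S₀ : Stack M frs) (F : Fits M frs x y)
             (unclaimed : ∀ {e} → ¬ Claim M x y e) where

      private
        M′ : Selection
        M′ = exchange M (Fits.x∈ F) (Path-map proj₁ (Fits.path F)) (Fits.open-end F) unclaimed

      module _ {w} (w-in : In M w) (x~w : x ~ w) where

        private
          displaced : ∀ {e} → In M e → e ~ x → e ≡ w
          displaced m e~x = ~-inj M m w-in (~-trans e~x x~w)

          claims-⊆ : ∀ {x′ y′} → ¬ Touch x′ y′ x →
            ∀ {e} → e ∈ claims M′ x′ y′ → e ∈ claims M x′ y′
          claims-⊆ ¬t e∈ with ∈-claims⁻ M′ e∈
          ... | inj₁ refl , t = contradiction t ¬t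
          ... | inj₂ (m , _) , t = ∈-claims⁺ M (m , t)

        hit⇒ : ∀ {frs} → ¬ Touched frs w → ∀ {e} → Hit M frs e → Hit M′ frs e
        hit⇒ ¬tw (m , t) =
          inj₂ (m , λ e~x → ¬tw (subst (Touched _) (displaced m e~x) t)) , t

        hit⇐ : ∀ {frs} → All (λ fr → ¬ Touch (edge fr) (halt fr) x) frs →
          ∀ {e} → Hit M′ frs e → Hit M frs e
        hit⇐ ¬tx (inj₁ refl , t) = contradiction t (All¬⇒¬Any ¬tx)
        hit⇐ ¬tx (inj₂ (m , _) , t) = m , t

        -- These frames touch neither the entering edge `x` nor the leaving edge `w`, so their hits
        -- stay the same and their bounds remain valid.
        Stack-exchange : ∀ {frs} → All (λ fr → ¬ Touch (edge fr) (halt fr) x) frs →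
          ¬ Touched frs w → Stack M frs → Stack M′ frs
        Stack-exchange _ _ (base free cov) = base free′ cov′
          where
          free′ : ∀ {e} → In M′ e → ¬ (e ~ a)
          free′ (inj₁ refl) e~a = free w-in (~-trans (~-sym (Fits.x∈ F) x~w) e~a)
          free′ (inj₂ (m , _)) = free m
          cov′ : Covers M′
          cov′ m₀ with cov m₀
          ... | e′ , m , p with e′ ~? x
          ...   | yes q = x , inj₁ refl , ~-trans (~-sym (In⊆items M m) q) p
          ...   | no ¬q = e′ , inj₂ (m , ¬q) , p
        Stack-exchange (¬t ∷ ¬ts) ¬tw (push S G (e , m , t) le) = push
          (Stack-exchange ¬ts (¬tw ∘ there) S)
          (Fits-resp (hit⇒ (¬tw ∘ there)) (hit⇐ ¬ts) G)
          (e , inj₂ (m , λ e~x → ¬tw (here (subst (Touch _ _) (displaced m e~x) t))) , t)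
          (≤-trans (length-⊆ (claims! M′ _ _) (claims-⊆ ¬t)) le)

        -- Unwinds to the oldest frame touching `w`. There the claim `w` disappears, and `x` is no
        -- new claim since no frame touches it, so the number of claims drops.
        pop : ∀ {frs} → All (λ fr → ¬ Touch (edge fr) (halt fr) x) frs →
          Touched frs w → Stack M frs → Handler frs → Augmentation
        pop {frame x′ y′ b ∷ frs} (¬t ∷ ¬ts) tw (push S G _ le) (h , hs) with touched? frs w
        ... | yes tw′ = pop ¬ts tw′ S hs
        pop {frame x′ y′ b ∷ frs} (¬t ∷ ¬ts) (there tw) (push S G _ le) (h , hs)
          | no ¬tw = contradiction tw ¬tw
        pop {frame x′ y′ b ∷ frs} (¬t ∷ ¬ts) (here tw) (push S G _ le) (h , hs)
          | no ¬tw = h M′ (Stack-exchange ¬ts ¬tw S) (Fits-resp (hit⇒ ¬tw) (hit⇐ ¬ts) G)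
            (≤-trans (length-⊆ (w∉ ∷ claims! M′ x′ y′) sub) le)
          where
          ¬claim : ¬ Claim M′ x′ y′ w
          ¬claim (inj₁ refl , t) = ¬t t
          ¬claim (inj₂ (_ , ≁) , _) = ≁ (~-sym (Fits.x∈ F) x~w)
          w∉ : All (w ≢_) (claims M′ x′ y′)
          w∉ = ¬Any⇒All¬ _ (¬claim ∘ ∈-claims⁻ M′)
          sub : ∀ {z} → z ∈ w ∷ claims M′ x′ y′ → z ∈ claims M x′ y′
          sub (here refl) = ∈-claims⁺ M (w-in , tw)
          sub (there z∈) = claims-⊆ ¬t z∈

      resolve : Handler frs → Augmentation
      resolve H with Fits.key F
      ... | inj₂ (w , (m , t) , x~w) = pop m x~w (Fits.avoids F) t S₀ H
      -- The class of `a` was unrepresented, so this exchange displaces nothing.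
      ... | inj₁ x~a = M′ , (x , inj₁ refl , x~a) , cov′
        where
        bottom : ∀ {frs} → Stack M frs → (∀ {e} → In M e → ¬ (e ~ a)) × Covers M
        bottom (base free cov) = free , cov
        bottom (push S _ _ _) = bottom S
        cov′ : Covers M′
        cov′ m₀ with e′ , m , p ← proj₂ (bottom S₀) m₀ =
          e′ , inj₂ (m , λ q → proj₁ (bottom S₀) m (~-trans q x~a)) , p

    walk : ∀ M frs {v s} → Acc (Arc (In M)) s → Path (Hit M frs) v s →
      ∃ λ y → Path (Hit M frs) v y × (∀ {w} → Hit M frs w → src w ≢ y)
    walk M frs {s = s} (acc rs) p with any? (λ e → src e ≟ᵛ s) (hits M frs)
    ... | no ¬h = s , p , λ h eq → ¬h (lose (∈-hits⁺ M h) eq)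
    ... | yes h with e , e∈ , refl ← find h =
      walk M frs (rs (e , proj₁ (∈-hits⁻ M e∈) , refl , refl)) (snoc p (∈-hits⁻ M e∈))

    related : List E → List E
    related ks = filter (λ e → any? (e ~?_) ks) items

    -- Inequivalent keys have disjoint classes, so the class sizes add up.
    related-large : ∀ ks → Unique ks → (∀ {k} → k ∈ ks → k ∈ items) →
      (∀ {k l} → k ∈ ks → l ∈ ks → k ~ l → k ≡ l) → length ks * (4 * d) ≤ length (related ks)
    related-large [] _ _ _ = z≤n
    related-large (k ∷ ks) (k∉ ∷ ks!) ks⊆ inj = begin
      4 * d + length ks * (4 * d)                         ≤⟨ +-mono-≤ (class-large (ks⊆ (here refl)))
                                                              (related-large ks ks! (ks⊆ ∘ there) (λ p q → inj (there p) (there q))) ⟩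
      length (filter (_~? k) items) + length (related ks) ≡⟨ length-++ (filter (_~? k) items) ⟨
      length (filter (_~? k) items ++ related ks)         ≤⟨ length-⊆ (++⁺ (filter⁺ (_~? k) items!)
                                                              (filter⁺ (λ e → any? (e ~?_) ks) items!) disj) sub ⟩
      length (related (k ∷ ks))                           ∎
      where
      open ≤-Reasoning
      rel⁻ : ∀ {z} → z ∈ related ks → z ∈ items × Any (z ~_) ks
      rel⁻ = ∈-filter⁻ (λ e → any? (e ~?_) ks) {xs = items}
      disj : ∀ {z} → ¬ (z ∈ filter (_~? k) items × z ∈ related ks)
      disj (p , q) with z∈ , z~k ← ∈-filter⁻ (_~? k) {xs = items} p
                   with l , l∈ , z~l ← find (proj₂ (rel⁻ q)) =
        All.lookup k∉ l∈ (inj (here refl) (there l∈) (~-trans (~-sym z∈ z~k) z~l))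
      sub : ∀ {z} → z ∈ filter (_~? k) items ++ related ks → z ∈ related (k ∷ ks)
      sub z∈ with ∈-++⁻ (filter (_~? k) items) z∈
      ... | inj₁ p with z∈ , z~k ← ∈-filter⁻ (_~? k) {xs = items} p =
        ∈-filter⁺ (λ e → any? (e ~?_) (k ∷ ks)) z∈ (here z~k)
      ... | inj₂ q with z∈ , r ← rel⁻ q =
        ∈-filter⁺ (λ e → any? (e ~?_) (k ∷ ks)) z∈ (there r)

    -- Counting the obstacles to the next frame

    module _ {M frs} (S : Stack M frs) where

      private
        W : List E
        W = hits M frs

        end : V → V
        end v = proj₁ (walk M frs (wf M v) nil)

        end-path : ∀ v → Path (Hit M frs) v (end v)
        end-path v = proj₁ (proj₂ (walk M frs (wf M v) nil))

        free : ∀ {frs} → Stack M frs → ∀ {e} → In M e → ¬ (e ~ a)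
        free (base f _) = f
        free (push S _ _ _) = free S

        Shares : E → E → Set
        Shares e w = tgt w ≡ tgt e ⊎ src w ≡ src e

        shares? : ∀ e → Decidable (Shares e)
        shares? e w = (tgt w ≟ᵛ tgt e) ⊎-dec (src w ≟ᵛ src e)

        Blocked : E → Set
        Blocked e = Touched frs e ⊎ Any (Shares e) W ⊎ end (tgt e) ≡ src e

        blocked? : Decidable Blocked
        blocked? e = touched? frs e ⊎-dec any? (shares? e) W ⊎-dec (end (tgt e) ≟ᵛ src e)

        -- The next edge may come from the class of `a` or of any current hit. These classes are
        -- distinct because `M` has at most one edge in each class and none in that of `a`.
        keys candidates : List E
        keys = a ∷ W
        candidates = related keys

        enough : suc (length W) * (4 * d) ≤ length candidates
        enough = related-large keys
          (¬Any⇒All¬ _ (λ a∈W → free S (proj₁ (∈-hits⁻ M a∈W)) ~-refl) ∷ hits! M frs)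
          (λ { (here refl) → a∈ ; (there w∈) → In⊆items M (proj₁ (∈-hits⁻ M w∈)) }) inj
          where
          inj : ∀ {k l} → k ∈ keys → l ∈ keys → k ~ l → k ≡ l
          inj (here refl) (here refl) _ = refl
          inj (here refl) (there w∈) r = contradiction (~-sym a∈ r) (free S (proj₁ (∈-hits⁻ M w∈)))
          inj (there w∈) (here refl) r = contradiction r (free S (proj₁ (∈-hits⁻ M w∈)))
          inj (there v∈) (there w∈) r = ~-inj M (proj₁ (∈-hits⁻ M v∈)) (proj₁ (∈-hits⁻ M w∈)) r

        slots : Frame → List E
        slots fr = tgtItems (tgt (edge fr)) ++ srcItems (src (edge fr)) ++ srcItems (halt fr)

        slots-length : ∀ fr → length (slots fr) ≤ 3 * d
        slots-length fr = begin
          length (slots fr) ≡⟨ length-++ (tgtItems _) ⟩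
          length (tgtItems (tgt (edge fr))) + length (srcItems (src (edge fr)) ++ srcItems (halt fr))
                            ≡⟨ cong (length (tgtItems (tgt (edge fr))) +_) (length-++ (srcItems _)) ⟩
          length (tgtItems (tgt (edge fr))) + (length (srcItems (src (edge fr))) + length (srcItems (halt fr)))
                            ≤⟨ +-mono-≤ (tgt-degree _) (+-mono-≤ (src-degree _) (≤-trans (src-degree _) (m≤m+n d 0))) ⟩
          3 * d             ∎
          where open ≤-Reasoning

        ∈-slots : ∀ {fr e} → e ∈ items → Touch (edge fr) (halt fr) e → e ∈ slots fr
        ∈-slots e∈ (inj₁ t) = ∈-++⁺ˡ (∈-tgtItems e∈ t)
        ∈-slots e∈ (inj₂ (inj₁ s)) = ∈-++⁺ʳ (tgtItems _) (∈-++⁺ˡ (∈-srcItems e∈ s))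
        ∈-slots e∈ (inj₂ (inj₂ s)) = ∈-++⁺ʳ (tgtItems _) (∈-++⁺ʳ (srcItems _) (∈-srcItems e∈ s))

        -- A hit w shares one of its two sides with a frame, so only its other side
        -- is charged to w.  In that list w itself makes room for the one edge that
        -- could close up the path of hits ending with w (Closes).
        TgtHit : E → Set
        TgtHit w = Any (λ fr → tgt w ≡ tgt (edge fr)) frs

        tgtHit? : Decidable TgtHit
        tgtHit? w = any? (λ fr → tgt w ≟ᵛ tgt (edge fr)) frs

        otherSide : E → List E
        otherSide w with tgtHit? w
        ... | yes _ = srcItems (src w)
        ... | no _ = tgtItems (tgt w)

        otherSide-length : ∀ w → length (otherSide w) ≤ d
        otherSide-length w with tgtHit? w
        ... | yes _ = src-degree (src w)
        ... | no _ = tgt-degree (tgt w)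

        ∈-otherSide : ∀ {w} → w ∈ items → w ∈ otherSide w
        ∈-otherSide {w} w∈ with tgtHit? w
        ... | yes _ = ∈-srcItems w∈ refl
        ... | no _ = ∈-tgtItems w∈ refl

        -- A hit meets some frame at one of its two sides; an edge sharing that side with the hit is
        -- touched by the same frame.
        covered-by-side : ∀ {w e} → Touched frs w → e ∈ items → Shares e w →
          Touched frs e ⊎ e ∈ otherSide w
        covered-by-side {w} tw e∈ sh with tgtHit? w
        covered-by-side {w} tw e∈ (inj₁ t) | yes h = inj₁ (Any.map (λ eq → inj₁ (trans (sym t) eq)) h)
        covered-by-side {w} tw e∈ (inj₂ s) | yes h = inj₂ (∈-srcItems e∈ (sym s))
        covered-by-side {w} tw e∈ (inj₁ t) | no ¬h = inj₂ (∈-tgtItems e∈ (sym t))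
        covered-by-side {w} tw e∈ (inj₂ s) | no ¬h = inj₁ (by-src ¬h tw)
          where
          by-src : ∀ {frs} → ¬ Any (λ fr → tgt w ≡ tgt (edge fr)) frs → Touched frs w → Touched frs _
          by-src ¬h (here (inj₁ t)) = contradiction (here t) ¬h
          by-src ¬h (here (inj₂ (inj₁ s′))) = here (inj₂ (inj₁ (trans (sym s) s′)))
          by-src ¬h (here (inj₂ (inj₂ s′))) = here (inj₂ (inj₂ (trans (sym s) s′)))
          by-src ¬h (there tw) = there (by-src (¬h ∘ there) tw)

        Closes : E → E → Set
        Closes w e = src e ≡ tgt w × ¬ Any (λ w′ → tgt w′ ≡ tgt e) W × end (tgt e) ≡ src e

        closes? : ∀ w → Decidable (Closes w)
        closes? w e = (src e ≟ᵛ tgt w) ×-dec ¬? (any? (λ w′ → tgt w′ ≟ᵛ tgt e) W)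
          ×-dec (end (tgt e) ≟ᵛ src e)

        -- Both paths of hits end at `tgt w` and start at vertices that no hit enters, so they have
        -- the same start. The two edges then agree in source and target.
        Closes-unique : ∀ {w e e′} → e ∈ items → e′ ∈ items → Closes w e → Closes w e′ → e ≡ e′
        Closes-unique {w} {e} {e′} e∈ e′∈ (s , ¬t , c) (s′ , ¬t′ , c′) =
          simple e∈ e′∈ (trans s (sym s′)) (Path-start-unique
            (λ p q → tgt-inj M (proj₁ p) (proj₁ q))
            (λ h eq → ¬t (lose (∈-hits⁺ M h) eq)) (λ h eq → ¬t′ (lose (∈-hits⁺ M h) eq))
            (end-path (tgt e)) (end-path (tgt e′)) (trans c (trans s (trans (sym s′) (sym c′)))))

        piece : E → List E
        piece w = filter (closes? w) items ++ filter (λ e → ¬? (e ≟ᵉ w)) (otherSide w)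

        piece-length : ∀ {w} → w ∈ W → length (piece w) ≤ d
        piece-length {w} w∈ = begin
          length (piece w) ≡⟨ length-++ (filter (closes? w) items) ⟩
          length (filter (closes? w) items) + length (filter (λ e → ¬? (e ≟ᵉ w)) (otherSide w))
                           ≤⟨ +-monoˡ-≤ _ (length-inj (λ _ → w) {ys = w ∷ []}
                               (filter⁺ (closes? w) items!) one (λ _ → here refl)) ⟩
          suc (length (filter (λ e → ¬? (e ≟ᵉ w)) (otherSide w)))
                           ≤⟨ filter-notAll (λ e → ¬? (e ≟ᵉ w)) (otherSide w)
                               (lose (∈-otherSide w∈items) (λ ¬eq → ¬eq refl)) ⟩
          length (otherSide w) ≤⟨ otherSide-length w ⟩
          d                ∎
          where
          open ≤-Reasoning
          w∈items : w ∈ items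
          w∈items = In⊆items M (proj₁ (∈-hits⁻ M w∈))
          one : ∀ {e e′} → e ∈ filter (closes? w) items → e′ ∈ filter (closes? w) items → w ≡ w → e ≡ e′
          one p q _ with e∈ , c ← ∈-filter⁻ (closes? w) {xs = items} p
                    with e′∈ , c′ ← ∈-filter⁻ (closes? w) {xs = items} q = Closes-unique e∈ e′∈ c c′

        obstacles : List E
        obstacles = concatMap slots frs ++ concatMap piece W

        -- There are `3 * d` obstacles at most per frame and `d` per hit. As frames do not outnumber
        -- hits, this makes `4 * d` per hit, one portion of `4 * d` short of the candidates.
        obstacles-few : length obstacles ≤ length W * (4 * d)
        obstacles-few = begin
          length obstacles                ≡⟨ length-++ (concatMap slots frs) ⟩
          length (concatMap slots frs) + length (concatMap piece W)
                                          ≤⟨ +-mono-≤ (length-concatMap≤ slots (3 * d) frs (λ {fr} _ → slots-length fr))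
                                                      (length-concatMap≤ piece d W piece-length) ⟩
          length frs * (3 * d) + length W * d
                                          ≤⟨ +-monoˡ-≤ _ (*-monoˡ-≤ (3 * d) (depth≤hits S)) ⟩
          length W * (3 * d) + length W * d ≡⟨ *-distribˡ-+ (length W) (3 * d) d ⟨
          length W * (3 * d + d)          ≡⟨ cong (length W *_) (+-comm (3 * d) d) ⟩
          length W * (4 * d)              ∎
          where open ≤-Reasoning

        touched-obstacle : ∀ {e} → e ∈ items → Touched frs e → e ∈ obstacles
        touched-obstacle e∈ t = ∈-++⁺ˡ (∈-concatMap⁺ slots (Any.map (λ {fr} → ∈-slots {fr} e∈) t))

        piece-obstacle : ∀ {w e} → w ∈ W → e ∈ piece w → e ∈ obstacles
        piece-obstacle w∈ e∈ = ∈-++⁺ʳ (concatMap slots frs) (∈-concatMap⁺ piece (lose w∈ e∈))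

        shares-obstacle : ∀ {e} → e ∈ items → Any (Shares e) W → e ∈ obstacles
        shares-obstacle {e} e∈ sh with w , w∈ , s ← find sh
          with covered-by-side (proj₂ (∈-hits⁻ M w∈)) e∈ s
        ... | inj₁ t = touched-obstacle e∈ t
        ... | inj₂ e∈side with e ≟ᵉ w
        ...   | yes refl = touched-obstacle e∈ (proj₂ (∈-hits⁻ M w∈))
        ...   | no e≢w = piece-obstacle w∈ (∈-++⁺ʳ (filter (closes? w) items)
                  (∈-filter⁺ (λ e → ¬? (e ≟ᵉ w)) e∈side e≢w))

        last-hit : ∀ {v z} → Path (Hit M frs) v z → v ≢ z → ∃ λ w → w ∈ W × z ≡ tgt w
        last-hit nil v≢z = contradiction refl v≢z
        last-hit (snoc {w} _ h) _ = w , ∈-hits⁺ M h , refl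

        blocked-obstacle : ∀ {e} → e ∈ items → Blocked e → e ∈ obstacles
        blocked-obstacle e∈ (inj₁ t) = touched-obstacle e∈ t
        blocked-obstacle e∈ (inj₂ (inj₁ sh)) = shares-obstacle e∈ sh
        blocked-obstacle {e} e∈ (inj₂ (inj₂ c)) with any? (shares? e) W
        ... | yes sh = shares-obstacle e∈ sh
        -- Looplessness makes the path nonempty, so it has a last hit `w`, and `e` closes up at `w`.
        ... | no ¬sh with w , w∈ , eq ← last-hit (end-path (tgt e))
                            (λ eq → loopless e∈ (sym (trans eq c))) =
          piece-obstacle w∈ (∈-++⁺ˡ (∈-filter⁺ (closes? w) e∈
            (trans (sym c) eq , ¬sh ∘ Any.map inj₁ , c)))

      find-frame : 0 < d → ∃₂ (Fits M frs)
      find-frame d>0 with any? (λ e → ¬? (blocked? e)) candidates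
      ... | no none = contradiction
              (≤-trans enough (≤-trans (length-⊆ (filter⁺ (λ e → any? (e ~?_) keys) items!) sub) obstacles-few))
              (<⇒≱ (m<n+m (length W * (4 * d)) (≤-trans d>0 (m≤m+n d _))))
        where
        sub : ∀ {e} → e ∈ candidates → e ∈ obstacles
        sub {e} e∈ with blocked? e
        ... | yes b = blocked-obstacle (proj₁ (∈-filter⁻ (λ e → any? (e ~?_) keys) {xs = items} e∈)) b
        ... | no ¬b = contradiction (lose e∈ ¬b) none
      ... | yes some with e , e∈c , ¬b ← find some
                     with e∈ , k ← ∈-filter⁻ (λ e → any? (e ~?_) keys) {xs = items} e∈c = e , end (tgt e) , record
        { x∈ = e∈ ; key = key k
        ; avoids = ¬Any⇒All¬ frs (¬b ∘ inj₁)
        ; fresh-tgt = λ h eq → ¬b (inj₂ (inj₁ (lose (∈-hits⁺ M h) (inj₁ eq))))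
        ; fresh-src = λ h eq → ¬b (inj₂ (inj₁ (lose (∈-hits⁺ M h) (inj₂ eq))))
        ; path = end-path (tgt e)
        ; stops = proj₂ (proj₂ (walk M frs (wf M (tgt e)) nil))
        ; open-end = ¬b ∘ inj₂ ∘ inj₂ }
        where
        key : Any (e ~_) keys → e ~ a ⊎ ∃ λ w → Hit M frs w × e ~ w
        key (here r) = inj₁ r
        key (there r) with w , w∈ , e~w ← find r = inj₂ (w , ∈-hits⁻ M w∈ , e~w)

    d>0 : 0 < d
    d>0 = ≤-trans (length-⊆ {xs = a ∷ []} ([] ∷ []) λ { (here refl) → ∈-srcItems a∈ refl }) (src-degree (src a))

    mutual
      -- `fuel` bounds the number of frames still to be pushed: by `depth≤hits` the stack is never
      -- higher than the number of items.
      search : ∀ fuel {M frs} → Stack M frs → Handler frs → length items < fuel + length frs → Augmentation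
      search zero {M} {frs} S H lt = contradiction
        (≤-trans lt (≤-trans (depth≤hits S) (length-filter (λ e → in? M e ×-dec touched? frs e) items)))
        (<-irrefl refl)
      search (suc fuel) {M} {frs} S H lt with x , y , F ← find-frame S d>0 =
        place fuel (length (claims M x y)) S F ≤-refl H (subst (length items <_) (sym (+-suc fuel (length frs))) lt)

      -- At a fixed depth the recursion is on `b`, which each call of the handler lowers; it
      -- descends in `fuel` when a further frame is sought.
      place : ∀ fuel b {M frs x y} → Stack M frs → Fits M frs x y → length (claims M x y) ≤ b →
        Handler frs → length items < fuel + suc (length frs) → Augmentation
      place fuel b {M} {frs} {x} {y} S F le H lt with claims M x y in eq
      place fuel b {M} S F le H lt | [] =
        resolve S F (λ c → case-[] (subst (_ ∈_) eq (∈-claims⁺ M c))) H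
        where
        case-[] : ∀ {e : E} → ¬ (e ∈ [])
        case-[] ()
      place fuel (suc b) {M} {frs} {x} {y} S F le H lt | e ∷ es =
        search fuel
          (push {b = suc b} S F (e , ∈-claims⁻ M (subst (e ∈_) (sym eq) (here refl)))
            (subst (λ l → length l ≤ suc b) (sym eq) le))
          ((λ M′ S′ F′ lt′ → place fuel b S′ F′ (≤-pred lt′) H lt) , H) lt

    augment : (∀ {e} → In M₀ e → ¬ (e ~ a)) → Augmentation
    augment free = search (suc (length items)) {M₀} (base free (λ m → _ , m , ~-refl)) tt
      (m≤m+n (suc (length items)) 0)

  empty : Selection
  empty .In _ = ⊥
  empty .in? _ = no id
  empty .In⊆items ()
  empty .src-inj ()
  empty .tgt-inj ()
  empty .~-inj ()
  empty .wf _ = acc λ ()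

  transversal : Σ Selection λ M → ∀ {e} → e ∈ items → ∃ λ e′ → In M e′ × e′ ~ e
  transversal = let M , cov = go items id in M , All.lookup cov
    where
    go : ∀ es → (∀ {e} → e ∈ es → e ∈ items) →
      Σ Selection λ M → All (λ e → ∃ λ e′ → In M e′ × e′ ~ e) es
    go [] _ = empty , []
    go (e ∷ es) sub with M , cov ← go es (sub ∘ there)
      with any? (λ e′ → in? M e′ ×-dec (e′ ~? e)) items
    ... | yes p with e′ , _ , r ← find p = M , (e′ , r) ∷ cov
    ... | no ¬p with M′ , new , keep ← augment e (sub (here refl)) M
                       (λ m r → ¬p (lose (In⊆items M m) (m , r))) =
      M′ , new ∷ All.map (λ { (e₁ , m , r) → let e₂ , m₂ , r₂ = keep m in e₂ , m₂ , ~-trans r₂ r }) cov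

-- Orbits of self-maps

least : {P : ℕ → Set} → Decidable P → ∀ k → P k → ∃ λ p → P p × (∀ {q} → q < p → ¬ P q)
least {P} P? k = go k (<-wellFounded k)
  where
  go : ∀ k → Acc _<_ k → P k → ∃ λ p → P p × (∀ {q} → q < p → ¬ P q)
  go k (acc rs) pk with anyUpTo? P? k
  ... | yes (j , j<k , pj) = go j (rs j<k) pj
  ... | no ¬p = k , pk , λ q<k pq → ¬p (_ , q<k , pq)

module _ {A : Set} (f : A → A) where

  Reach : A → A → Set
  Reach v w = ∃ λ k → fold v f k ≡ w

  -- `Reach` allows zero steps; starting from `f v` forces a return after at least one.
  Periodic : A → Set
  Periodic v = Reach (f v) v

  fold-suc : ∀ v k → fold v f (suc k) ≡ fold (f v) f k
  fold-suc v zero = refl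
  fold-suc v (suc k) = cong f (fold-suc v k)

  Reach-trans : ∀ {u v w} → Reach u v → Reach v w → Reach u w
  Reach-trans {u} (j , refl) (k , refl) = k + j , fold-+ u f k

  Reach-cong : ∀ {v w} → Reach v w → Reach (f v) (f w)
  Reach-cong {v} (k , refl) = k , sym (fold-suc v k)

  Periodic-sym : ∀ {v w} → Periodic v → Reach v w → Reach w v
  Periodic-sym per (zero , refl) = 0 , refl
  Periodic-sym {v} per (suc k , refl) with Periodic-sym per (k , refl)
  ... | zero , eq = subst (λ u → Reach (f u) v) (sym eq) per
  ... | suc j , eq = j , trans (sym (fold-suc (fold v f k) j)) eq

  Periodic-fold : ∀ {v} k → Periodic v → Periodic (fold v f k)
  Periodic-fold zero per = per
  Periodic-fold (suc k) per = Reach-cong (Periodic-fold k per)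

  fold-period : ∀ {u k} → fold u f (suc k) ≡ u → ∀ j → fold u f (j * suc k) ≡ u
  fold-period eq zero = refl
  fold-period {u} {k} eq (suc j) =
    trans (fold-+ u f (suc k) {j * suc k}) (trans (cong (λ z → fold z f (suc k)) (fold-period eq j)) eq)

  -- The return times are `j + 1` and `k + 1`. Both exponents equal `(j + 1) * (k + 1) - 1`, so
  -- equally many steps lead from the common image to `v` and to `w`.
  Periodic-injective : ∀ {v w} → Periodic v → Periodic w → f v ≡ f w → v ≡ w
  Periodic-injective {v} {w} (j , p) (k , q) eq = begin
    v                                   ≡⟨ p ⟨
    fold (f v) f j                      ≡⟨ cong (λ z → fold z f j) (fold-period (cong f p) k) ⟨
    fold (fold (f v) f (k * suc j)) f j ≡⟨ fold-+ (f v) f j ⟨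
    fold (f v) f (j + k * suc j)        ≡⟨ cong₂ (λ z i → fold z f i) eq exponents ⟩
    fold (f w) f (k + j * suc k)        ≡⟨ fold-+ (f w) f k ⟩
    fold (fold (f w) f (j * suc k)) f k ≡⟨ cong (λ z → fold z f k) (fold-period (cong f q) j) ⟩
    fold (f w) f k                      ≡⟨ q ⟩
    w                                   ∎
    where
    open ≡-Reasoning
    exponents : j + k * suc j ≡ k + j * suc k
    exponents = begin
      j + k * suc j   ≡⟨ cong (j +_) (*-suc k j) ⟩
      j + (k + k * j) ≡⟨ +-assoc j k (k * j) ⟨
      j + k + k * j   ≡⟨ cong₂ _+_ (+-comm j k) (*-comm k j) ⟩
      k + j + j * k   ≡⟨ +-assoc k j (j * k) ⟩
      k + (j + j * k) ≡⟨ cong (k +_) (*-suc j k) ⟨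
      k + j * suc k   ∎

module _ {n} (f : Fin n → Fin n) where

  repetition : ∀ v → ∃ λ i → ∃ λ m → i + suc m ≤ n × fold v f (suc m + i) ≡ fold v f i
  repetition v with i , j , i<j , eq ← pigeonhole (n<1+n n) (λ i → fold v f (toℕ i))
    with m , k+i ← m≤n⇒∃[o]m+o≡n i<j =
      toℕ i , m , ≤-trans (≤-reflexive (trans (+-suc (toℕ i) m) k+i)) (≤-pred (toℕ<n j)) ,
      trans (cong (fold v f) (trans (cong suc (+-comm m (toℕ i))) k+i)) (sym eq)

  eventually-periodic : ∀ v → ∃ λ k → Periodic f (fold v f k)
  eventually-periodic v with i , m , _ , eq ← repetition v =
    i , m , trans (sym (fold-suc f (fold v f i) m)) (trans (sym (fold-+ v f (suc m))) eq)

  -- By pigeonhole the first `n` steps of a longer walk contain a loop, which can be cut out.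
  -- Reachability thus becomes decidable by bounded search.
  shorten : ∀ {v w} k → Acc _<_ k → fold v f k ≡ w → ∃ λ j → j < n × fold v f j ≡ w
  shorten {v} {w} k (acc rs) eq with k <? n
  ... | yes k<n = k , k<n , eq
  ... | no k≮n with i , m , le , rep ← repetition v
      with o , refl ← m≤n⇒∃[o]m+o≡n (≤-trans le (≮⇒≥ k≮n)) =
    shorten (o + i) (rs less) (begin
      fold v f (o + i)               ≡⟨ fold-+ v f o ⟩
      fold (fold v f i) f o          ≡⟨ cong (λ z → fold z f o) rep ⟨
      fold (fold v f (suc m + i)) f o ≡⟨ fold-+ v f o ⟨
      fold v f (o + (suc m + i))     ≡⟨ cong (fold v f) (trans (+-comm o _) (cong (_+ o) (+-comm (suc m) i))) ⟩
      fold v f (i + suc m + o)       ≡⟨ eq ⟩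
      w                              ∎)
    where
    open ≡-Reasoning
    less : o + i < i + suc m + o
    less = ≤-trans (≤-reflexive (cong suc (+-comm o i)))
      (≤-trans (≤-reflexive (sym (cong (_+ o) (+-comm i 1)))) (+-monoˡ-≤ o (+-monoʳ-≤ i (s≤s z≤n))))

  reach? : Binary.Decidable (Reach f)
  reach? v w = map′ (λ (j , _ , eq) → j , eq) (λ (k , eq) → shorten k (<-wellFounded k) eq)
    (anyUpTo? (λ j → fold v f j ≟ᶠ w) n)

-- König's edge-colouring theorem

Star : {A X : Set} → (A → X) → List A → Set
Star l xs = ∀ {x y} → x ∈ xs → y ∈ xs → l x ≡ l y

-- A bipartite multigraph is given by its edges and two end maps. Degrees are bounded through lists
-- of distinct edges with a common end.
DegreeBound : {A X : Set} → (A → X) → ℕ → Set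
DegreeBound l d = ∀ {xs} → Unique xs → Star l xs → length xs ≤ d

Proper : {A X : Set} {d : ℕ} → (A → X) → (A → Fin d) → Set
Proper l c = ∀ {x y} → c x ≡ c y → l x ≡ l y → x ≡ y

DegreeBound-suc : ∀ {X : Set} {m d} {l : Fin (suc m) → X} → DegreeBound l d → DegreeBound (l ∘ suc) d
DegreeBound-suc {l = l} deg {xs} xs! star =
  subst (_≤ _) (length-map suc xs) (deg (map⁺ Fin.suc-injective xs!) star′)
  where
  star′ : Star l (map suc xs)
  star′ p q with _ , p′ , refl ← ∈-map⁻ suc p with _ , q′ , refl ← ∈-map⁻ suc q = star p′ q′

Missing : {A X : Set} {d : ℕ} → (A → X) → (A → Fin d) → X → Fin d → Set
Missing l c a γ = ∀ {x} → l x ≡ a → c x ≢ γ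

-- If every colour occurred at `l zero`, one edge of each colour together with `zero` itself would
-- make `d + 1` edges there.
missing-colour : ∀ {X : Set} (_≟_ : DecidableEquality X) {m d} {l : Fin (suc m) → X}
  {c : Fin m → Fin d} → DegreeBound l d → ∃ (Missing (l ∘ suc) c (l zero))
missing-colour _≟_ {m} {d} {l} {c} deg
  with Fin.any? (λ γ → ¬? (Fin.any? (λ x → (l (suc x) ≟ l zero) ×-dec (c x ≟ᶠ γ))))
... | yes (γ , ¬used) = γ , λ {x} eq cx → ¬used (x , eq , cx)
... | no all-used = contradiction
        (deg {zero ∷ map (suc ∘ g) (allFin d)} (¬Any⇒All¬ _ zero∉ ∷ map⁺ g-inj (allFin⁺ d)) star)
        (<⇒≱ (s≤s (≤-reflexive (sym (trans (length-map (suc ∘ g) (allFin d)) (length-tabulate id))))))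
  where
  used : ∀ γ → ∃ λ x → l (suc x) ≡ l zero × c x ≡ γ
  used γ = decidable-stable (Fin.any? (λ x → (l (suc x) ≟ l zero) ×-dec (c x ≟ᶠ γ)))
    (λ ¬u → all-used (γ , ¬u))
  g : Fin d → Fin m
  g = proj₁ ∘ used
  g-inj : ∀ {γ δ} → suc (g γ) ≡ suc (g δ) → γ ≡ δ
  g-inj {γ} {δ} eq = trans (sym (proj₂ (proj₂ (used γ))))
    (trans (cong c (Fin.suc-injective eq)) (proj₂ (proj₂ (used δ))))
  zero∉ : ¬ (zero ∈ map (suc ∘ g) (allFin d))
  zero∉ z∈ with _ , _ , () ← ∈-map⁻ (suc ∘ g) z∈
  at-zero : ∀ {x} → x ∈ zero ∷ map (suc ∘ g) (allFin d) → l x ≡ l zero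
  at-zero (here refl) = refl
  at-zero (there x∈) with γ , _ , refl ← ∈-map⁻ (suc ∘ g) x∈ = proj₁ (proj₂ (used γ))
  star : Star l (zero ∷ map (suc ∘ g) (allFin d))
  star p q = trans (at-zero p) (sym (at-zero q))

-- Alternating chains in two colours

module Kempe {L R : Set} (_≟ˡ_ : DecidableEquality L) (_≟ʳ_ : DecidableEquality R)
  {m d} {l : Fin m → L} {r : Fin m → R} {c : Fin m → Fin d}
  (proper-l : Proper l c) (proper-r : Proper r c) {α β : Fin d} (α≢β : α ≢ β)
  {e₁ : Fin m} (e₁-α : c e₁ ≡ α) (missing-β : Missing r c (r e₁) β) where

  private
    left? : ∀ x → Dec (∃ λ y → l y ≡ l x × c y ≡ β)
    left? x = Fin.any? (λ y → (l y ≟ˡ l x) ×-dec (c y ≟ᶠ β))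

    right? : ∀ x → Dec (∃ λ y → r y ≡ r x × c y ≡ α)
    right? x = Fin.any? (λ y → (r y ≟ʳ r x) ×-dec (c y ≟ᶠ α))

    -- Where the chain stops, an edge is its own successor. The chain is then an orbit of a
    -- self-map, and `reach?` decides membership in it.
    next : Fin m → Fin m
    next x with c x ≟ᶠ α | c x ≟ᶠ β | left? x | right? x
    ... | yes _ | _ | yes (y , _) | _ = y
    ... | yes _ | _ | no _ | _ = x
    ... | no _ | yes _ | _ | yes (y , _) = y
    ... | no _ | yes _ | _ | no _ = x
    ... | no _ | no _ | _ | _ = x

    next-α : ∀ {x y} → c x ≡ α → c y ≡ β → l y ≡ l x → next x ≡ y
    next-α {x} {y} cx cy ly with c x ≟ᶠ α | c x ≟ᶠ β | left? x | right? x
    ... | yes _ | _ | yes (z , lz , cz) | _ = proper-l (trans cz (sym cy)) (trans lz (sym ly))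
    ... | yes _ | _ | no ¬left | _ = contradiction (y , ly , cy) ¬left
    ... | no ¬α | _ | _ | _ = contradiction cx ¬α

    next-β : ∀ {x y} → c x ≡ β → c y ≡ α → r y ≡ r x → next x ≡ y
    next-β {x} {y} cx cy ry with c x ≟ᶠ α | c x ≟ᶠ β | left? x | right? x
    ... | yes cx′ | _ | _ | _ = contradiction (trans (sym cx′) cx) α≢β
    ... | no _ | yes _ | _ | yes (z , rz , cz) = proper-r (trans cz (sym cy)) (trans rz (sym ry))
    ... | no _ | yes _ | _ | no ¬right = contradiction (y , ry , cy) ¬right
    ... | no _ | no ¬β | _ | _ = contradiction cx ¬β

    data Next (x : Fin m) : Fin m → Set where
      stay : Next x x
      via-l : ∀ {y} → c x ≡ α → c y ≡ β → l x ≡ l y → Next x y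
      via-r : ∀ {y} → c x ≡ β → c y ≡ α → r x ≡ r y → Next x y

    next-view : ∀ x → Next x (next x)
    next-view x with c x ≟ᶠ α | c x ≟ᶠ β | left? x | right? x
    ... | yes cx | _ | yes (_ , ly , cy) | _ = via-l cx cy (sym ly)
    ... | yes _ | _ | no _ | _ = stay
    ... | no _ | yes cx | _ | yes (_ , ry , cy) = via-r cx cy (sym ry)
    ... | no _ | yes _ | _ | no _ = stay
    ... | no _ | no _ | _ | _ = stay

    Chain : Fin m → Set
    Chain = Reach next e₁

    chain-next : ∀ {x} → Chain x → Chain (next x)
    chain-next (k , eq) = suc k , cong next eq

    -- The chain starts at an `α`-edge and crosses left ends only from `α` to `β`. Together with
    -- `chain-α` this closes the chain against its direction as well, so swapping its colours keeps
    -- the colouring proper.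
    chain-β : ∀ k {y} → fold e₁ next k ≡ y → c y ≡ β → ∃ λ x → Chain x × c x ≡ α × l x ≡ l y
    chain-β zero refl cy = contradiction (trans (sym e₁-α) cy) α≢β
    chain-β (suc k) refl cy with next (fold e₁ next k) | next-view (fold e₁ next k)
    ... | _ | stay = chain-β k refl cy
    ... | _ | via-l cx _ lx = _ , (k , refl) , cx , lx
    ... | _ | via-r _ cy′ _ = contradiction (trans (sym cy′) cy) α≢β

    chain-α : ∀ k {y} → fold e₁ next k ≡ y → c y ≡ α → y ≡ e₁ ⊎ ∃ λ x → Chain x × c x ≡ β × r x ≡ r y
    chain-α zero refl cy = inj₁ refl
    chain-α (suc k) refl cy with next (fold e₁ next k) | next-view (fold e₁ next k)
    ... | _ | stay = chain-α k refl cy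
    ... | _ | via-r cx _ rx = inj₂ (_ , (k , refl) , cx , rx)
    ... | _ | via-l _ cy′ _ = contradiction (trans (sym cy) cy′) α≢β

    swap : Fin d → Fin d
    swap γ with γ ≟ᶠ α | γ ≟ᶠ β
    ... | yes _ | _ = β
    ... | no _ | yes _ = α
    ... | no _ | no _ = γ

    data Swap (γ : Fin d) : Fin d → Set where
      is-α : γ ≡ α → Swap γ β
      is-β : γ ≡ β → Swap γ α
      other : γ ≢ α → γ ≢ β → Swap γ γ

    swap-view : ∀ γ → Swap γ (swap γ)
    swap-view γ with γ ≟ᶠ α | γ ≟ᶠ β
    ... | yes p | _ = is-α p
    ... | no _ | yes q = is-β q
    ... | no ¬p | no ¬q = other ¬p ¬q

    Swap-inj : ∀ {γ γ′ δ δ′} → Swap γ δ → Swap γ′ δ′ → δ ≡ δ′ → γ ≡ γ′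
    Swap-inj (is-α refl) (is-α refl) _ = refl
    Swap-inj (is-α _) (is-β _) eq = contradiction (sym eq) α≢β
    Swap-inj (is-α _) (other _ ¬β) eq = contradiction (sym eq) ¬β
    Swap-inj (is-β _) (is-α _) eq = contradiction eq α≢β
    Swap-inj (is-β refl) (is-β refl) _ = refl
    Swap-inj (is-β _) (other ¬α _) eq = contradiction (sym eq) ¬α
    Swap-inj (other _ ¬β) (is-α _) eq = contradiction eq ¬β
    Swap-inj (other ¬α _) (is-β _) eq = contradiction eq ¬α
    Swap-inj (other _ _) (other _ _) eq = eq

  recolour : Fin m → Fin d
  recolour x with reach? next e₁ x
  ... | yes _ = swap (c x)
  ... | no _ = c x

  private
    mixed-l : ∀ {x y δ} → Chain x → ¬ Chain y → Swap (c x) δ → δ ≡ c y → l x ≡ l y → x ≡ y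
    mixed-l p ¬q (is-α cx) eq lxy =
      contradiction (subst Chain (next-α cx (sym eq) (sym lxy)) (chain-next p)) ¬q
    mixed-l (k , p) ¬q (is-β cx) eq lxy with x′ , ch , cx′ , lx′ ← chain-β k p cx =
      contradiction (subst Chain (proper-l (trans cx′ eq) (trans lx′ lxy)) ch) ¬q
    mixed-l p ¬q (other _ _) eq lxy = proper-l eq lxy

    mixed-r : ∀ {x y δ} → Chain x → ¬ Chain y → Swap (c x) δ → δ ≡ c y → r x ≡ r y → x ≡ y
    mixed-r (k , p) ¬q (is-α cx) eq rxy with chain-α k p cx
    -- The initial edge has no predecessor to appeal to; here `β` is missing at its right end.
    ... | inj₁ refl = contradiction (sym eq) (missing-β (sym rxy))
    ... | inj₂ (x′ , ch , cx′ , rx′) =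
      contradiction (subst Chain (proper-r (trans cx′ eq) (trans rx′ rxy)) ch) ¬q
    mixed-r p ¬q (is-β cx) eq rxy =
      contradiction (subst Chain (next-β cx (sym eq) (sym rxy)) (chain-next p)) ¬q
    mixed-r p ¬q (other _ _) eq rxy = proper-r eq rxy

  recolour-proper-l : Proper l recolour
  recolour-proper-l {x} {y} eq lxy with reach? next e₁ x | reach? next e₁ y
  ... | yes p | yes q = proper-l (Swap-inj (swap-view (c x)) (swap-view (c y)) eq) lxy
  ... | yes p | no ¬q = mixed-l p ¬q (swap-view (c x)) eq lxy
  ... | no ¬p | yes q = sym (mixed-l q ¬p (swap-view (c y)) (sym eq) (sym lxy))
  ... | no ¬p | no ¬q = proper-l eq lxy

  recolour-proper-r : Proper r recolour
  recolour-proper-r {x} {y} eq rxy with reach? next e₁ x | reach? next e₁ y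
  ... | yes p | yes q = proper-r (Swap-inj (swap-view (c x)) (swap-view (c y)) eq) rxy
  ... | yes p | no ¬q = mixed-r p ¬q (swap-view (c x)) eq rxy
  ... | no ¬p | yes q = sym (mixed-r q ¬p (swap-view (c y)) (sym eq) (sym rxy))
  ... | no ¬p | no ¬q = proper-r eq rxy

  private
    swapped-to-α : ∀ {γ δ} → Swap γ δ → δ ≡ α → γ ≡ β
    swapped-to-α (is-α _) eq = contradiction (sym eq) α≢β
    swapped-to-α (is-β γ≡β) _ = γ≡β
    swapped-to-α (other ¬α _) eq = contradiction eq ¬α

  recolour-missing-r : Missing r recolour (r e₁) α
  recolour-missing-r {x} rx eq with reach? next e₁ x
  ... | yes _ = missing-β rx (swapped-to-α (swap-view (c x)) eq)
  ... | no ¬p = ¬p (0 , proper-r (trans e₁-α (sym eq)) (sym rx))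

  -- A chain edge that becomes `α` was a `β`-edge, entered through its left end from an `α`-edge; at
  -- `a` there is none. This is where bipartiteness matters.
  recolour-missing-l : ∀ {a} → Missing l c a α → Missing l recolour a α
  recolour-missing-l missing {x} lx eq with reach? next e₁ x
  ... | no _ = missing lx eq
  ... | yes (k , p) with _ , _ , cx′ , lx′ ← chain-β k p (swapped-to-α (swap-view (c x)) eq) =
    missing (trans lx′ lx) cx′

module _ {L R : Set} (_≟ˡ_ : DecidableEquality L) (_≟ʳ_ : DecidableEquality R) where

  private
    -- If `α` occurs at `b`, swapping the chain that starts with this edge frees `α` at `b` and
    -- keeps it free at `a`, so the new edge can receive `α`.
    common-missing : ∀ {m d} {l : Fin m → L} {r : Fin m → R} {c : Fin m → Fin d} {a b α β} →
      Proper l c → Proper r c → Missing l c a α → Missing r c b β →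
      ∃ λ (c′ : Fin m → Fin d) → Proper l c′ × Proper r c′ × Missing l c′ a α × Missing r c′ b α
    common-missing {r = r} {c} {b = b} {α} {β} pl pr ma mb
      with Fin.any? (λ x → (r x ≟ʳ b) ×-dec (c x ≟ᶠ α))
    ... | no ¬e = c , pl , pr , ma , λ {x} rx cx → ¬e (x , rx , cx)
    ... | yes (e₁ , refl , e₁-α) =
      recolour , recolour-proper-l , recolour-proper-r , recolour-missing-l ma , recolour-missing-r
      where
      α≢β : α ≢ β
      α≢β refl = mb refl e₁-α
      open Kempe _≟ˡ_ _≟ʳ_ pl pr α≢β e₁-α mb

    Proper-extend : ∀ {m d} {X : Set} {l : Fin (suc m) → X} {c : Fin m → Fin d} {α} →
      Proper (l ∘ suc) c → Missing (l ∘ suc) c (l zero) α →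
      Proper l (λ { zero → α ; (suc x) → c x })
    Proper-extend pl ml {zero} {zero} _ _ = refl
    Proper-extend pl ml {zero} {suc y} eq leq = contradiction (sym eq) (ml (sym leq))
    Proper-extend pl ml {suc x} {zero} eq leq = contradiction eq (ml leq)
    Proper-extend pl ml {suc x} {suc y} eq leq = cong suc (pl eq leq)

  bipartite-edge-colouring : ∀ {m d} {l : Fin m → L} {r : Fin m → R} →
    DegreeBound l d → DegreeBound r d → ∃ λ (c : Fin m → Fin d) → Proper l c × Proper r c
  bipartite-edge-colouring {zero} dl dr = (λ ()) , (λ { {()} }) , (λ { {()} })
  bipartite-edge-colouring {suc m} {l = l} {r} dl dr
    with c , pl , pr ← bipartite-edge-colouring (DegreeBound-suc {l = l} dl) (DegreeBound-suc {l = r} dr)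
    with α , ma ← missing-colour _≟ˡ_ {c = c} dl | β , mb ← missing-colour _≟ʳ_ {c = c} dr
    with c′ , pl′ , pr′ , ma′ , mb′ ← common-missing pl pr ma mb =
      _ , Proper-extend {l = l} pl′ ma′ , Proper-extend {l = r} pr′ mb′

-- Digraphs and branchings

trues : ∀ {n} → (Fin n → Bool) → List (Fin n)
trues {n} p = filter (λ u → p u ≟ᵇ true) (allFin n)

∈-trues⁺ : ∀ {n} {p : Fin n → Bool} {u} → p u ≡ true → u ∈ trues p
∈-trues⁺ {p = p} {u} = ∈-filter⁺ (λ u → p u ≟ᵇ true) (∈-allFin u)

∈-trues⁻ : ∀ {n} {p : Fin n → Bool} {u} → u ∈ trues p → p u ≡ true
∈-trues⁻ {n} {p} u∈ = proj₂ (∈-filter⁻ (λ u → p u ≟ᵇ true) {xs = allFin n} u∈)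

trues! : ∀ {n} (p : Fin n → Bool) → Unique (trues p)
trues! {n} p = filter⁺ (λ u → p u ≟ᵇ true) (allFin⁺ n)

countV≡length-trues : ∀ {n} (p : Fin n → Bool) → countV p ≡ length (trues p)
countV≡length-trues {n} p = go (allFin n)
  where
  go : ∀ xs → sum (map (λ u → if p u then 1 else 0) xs) ≡ length (filter (λ u → p u ≟ᵇ true) xs)
  go [] = refl
  go (x ∷ xs) with p x
  ... | true = cong suc (go xs)
  ... | false = go xs

length≤countV : ∀ {n} {p : Fin n → Bool} {xs} → Unique xs → (∀ {x} → x ∈ xs → p x ≡ true) →
  length xs ≤ countV p
length≤countV {p = p} xs! all = ≤-trans (length-⊆ xs! (∈-trues⁺ ∘ all))
  (≤-reflexive (sym (countV≡length-trues p)))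

countV≤ : ∀ {n} (p : Fin n → Bool) {N} →
  (∀ {xs} → Unique xs → (∀ {x} → x ∈ xs → p x ≡ true) → length xs ≤ N) → countV p ≤ N
countV≤ p bound = ≤-trans (≤-reflexive (countV≡length-trues p)) (bound (trues! p) ∈-trues⁻)

countV≤1 : ∀ {n} (p : Fin n → Bool) → (∀ {x y} → p x ≡ true → p y ≡ true → x ≡ y) → countV p ≤ 1
countV≤1 p one = countV≤ p λ xs! all →
  length-inj (λ _ → 0) {ys = 0 ∷ []} xs! (λ x∈ y∈ _ → one (all x∈) (all y∈)) (λ _ → here refl)

maxV-upper : ∀ {n} (h : Fin n → ℕ) v → h v ≤ maxV h
maxV-upper {n} h v = go (∈-allFin v)
  where
  go : ∀ {xs} → v ∈ xs → h v ≤ foldr _⊔_ 0 (map h xs)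
  go (here refl) = m≤m⊔n _ _
  go (there v∈) = ≤-trans (go v∈) (m≤n⊔m _ _)

-- If `a` exceeded `suc m * q`, then `a + m` would be at least `suc q * suc m`, and the quotient at
-- least `suc q`.
ceilDivSuc≤⇒ : ∀ a m {q} → ceilDivSuc a m ≤ q → a ≤ suc m * q
ceilDivSuc≤⇒ a m {q} le = ≮⇒≥ λ lt → <⇒≱ (s≤s le) (begin
  suc q                         ≡⟨ m*n/n≡m (suc q) (suc m) ⟨
  suc q * suc m / suc m         ≤⟨ /-monoˡ-≤ (suc m) (begin
    suc q * suc m               ≡⟨ *-comm (suc q) (suc m) ⟩
    suc m * suc q               ≡⟨ *-suc (suc m) q ⟩
    suc m + suc m * q           ≡⟨ +-comm (suc m) (suc m * q) ⟩
    suc m * q + suc m           ≡⟨ +-suc (suc m * q) m ⟩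
    suc (suc m * q) + m         ≤⟨ +-monoˡ-≤ m lt ⟩
    a + m                       ∎) ⟩
  (a + m) / suc m               ∎)
  where open ≤-Reasoning

lookup-injective : ∀ {A : Set} {xs : List A} → Unique xs → ∀ {i j} → lookup xs i ≡ lookup xs j → i ≡ j
lookup-injective (x∉ ∷ xs!) {zero} {zero} eq = refl
lookup-injective (x∉ ∷ xs!) {zero} {suc j} eq = contradiction eq (All.lookup x∉ (∈-lookup j))
lookup-injective (x∉ ∷ xs!) {suc i} {zero} eq = contradiction (sym eq) (All.lookup x∉ (∈-lookup i))
lookup-injective (x∉ ∷ xs!) {suc i} {suc j} eq = cong suc (lookup-injective xs! eq)

Coloured : ∀ {n d} → Digraph n → (Fin n → Fin n → Maybe (Fin d)) → Fin d → Fin n → Fin n → Set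
Coloured D colour i u v = D u v ≡ true × colour u v ≡ just i

-- `Maybe` accommodates pairs that are not arcs, and the case `d = 0`, in which there is no colour
-- at all.
record Splitting {n} (D : Digraph n) (k : Fin n → ℕ) (d : ℕ) : Set where
  field
    colour : Fin n → Fin n → Maybe (Fin d)
    total : ∀ {u v} → D u v ≡ true → ∃ λ i → colour u v ≡ just i
    in-unique : ∀ {i u u′ v} → Coloured D colour i u v → Coloured D colour i u′ v → u ≡ u′
    out-bound : ∀ {i u xs} → Unique xs → (∀ {v} → v ∈ xs → Coloured D colour i u v) → length xs ≤ k u

-- Ranks of out-arcs and the split graph

module _ {n} (D : Digraph n) where

  private
    earlier? : ∀ u (v : Fin n) → Decidable (λ w → D u w ≡ true × w <ᶠ v)
    earlier? u v w = (D u w ≟ᵇ true) ×-dec (w <ᶠ? v)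

    earlier : Fin n → Fin n → List (Fin n)
    earlier u v = filter (earlier? u v) (allFin n)

    ∈-earlier⁻ : ∀ {u v w} → w ∈ earlier u v → D u w ≡ true × w <ᶠ v
    ∈-earlier⁻ {u} {v} w∈ = proj₂ (∈-filter⁻ (earlier? u v) {xs = allFin n} w∈)

    ∷-earlier! : ∀ u v → Unique (v ∷ earlier u v)
    ∷-earlier! u v = ¬Any⇒All¬ _ (λ v∈ → <ᶠ-irrefl refl (proj₂ (∈-earlier⁻ v∈))) ∷
      filter⁺ (earlier? u v) (allFin⁺ n)

  rank : Fin n → Fin n → ℕ
  rank u v = length (earlier u v)

  rank-mono : ∀ {u v v′} → D u v ≡ true → v <ᶠ v′ → rank u v < rank u v′
  rank-mono {u} {v} {v′} arc v<v′ = length-⊆ (∷-earlier! u v) sub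
    where
    sub : ∀ {w} → w ∈ v ∷ earlier u v → w ∈ earlier u v′
    sub (here refl) = ∈-filter⁺ (earlier? u v′) (∈-allFin v) (arc , v<v′)
    sub {w} (there w∈) = let a , w<v = ∈-earlier⁻ w∈ in
      ∈-filter⁺ (earlier? u v′) (∈-allFin w) (a , <ᶠ-trans w<v v<v′)

  rank-injective : ∀ {u v v′} → D u v ≡ true → D u v′ ≡ true → rank u v ≡ rank u v′ → v ≡ v′
  rank-injective {u} {v} {v′} a a′ eq with <ᶠ-cmp v v′
  ... | tri< lt _ _ = contradiction eq (<⇒≢ (rank-mono a lt))
  ... | tri≈ _ v≡v′ _ = v≡v′
  ... | tri> _ _ gt = contradiction (sym eq) (<⇒≢ (rank-mono a′ gt))

  rank<outdeg : ∀ {u v} → D u v ≡ true → rank u v < outdeg D u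
  rank<outdeg {u} {v} arc = length≤countV {p = D u} (∷-earlier! u v)
    λ { (here refl) → arc ; (there w∈) → proj₁ (∈-earlier⁻ w∈) }

  module _ (k : Fin n → ℕ) (d-1 : ℕ) (in-deg : ∀ v → indeg D v ≤ suc d-1)
           (out-deg : ∀ v → outdeg D v ≤ k v * suc d-1) where

    private
      d : ℕ
      d = suc d-1

      isArc? : Decidable (λ ((u , v) : Fin n × Fin n) → D u v ≡ true)
      isArc? (u , v) = D u v ≟ᵇ true

      arcs : List (Fin n × Fin n)
      arcs = filter isArc? (cartesianProduct (allFin n) (allFin n))

      arcs! : Unique arcs
      arcs! = filter⁺ isArc? (cartesianProduct⁺ (allFin⁺ n) (allFin⁺ n))

      tail head : Fin (length arcs) → Fin n
      tail i = proj₁ (lookup arcs i)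
      head i = proj₂ (lookup arcs i)

      is-arc : ∀ i → D (tail i) (head i) ≡ true
      is-arc i = proj₂ (∈-filter⁻ isArc? {xs = cartesianProduct (allFin n) (allFin n)} (∈-lookup i))

      arc-ext : ∀ {i j} → tail i ≡ tail j → head i ≡ head j → i ≡ j
      arc-ext t h = lookup-injective arcs! (cong₂ _,_ t h)

      -- Each tail u is replaced by copies (u , q), the q-th one carrying
      -- the arcs whose rank at u lies in [qd , (q+1)d).
      copy : Fin (length arcs) → Fin n × ℕ
      copy i = tail i , rank (tail i) (head i) / d

      -- Arcs at one copy have equal quotients, so the remainders modulo `d` tell their ranks apart.
      copy-degree : DegreeBound copy d
      copy-degree {xs} xs! star = ≤-trans
        (length-inj (λ i → rank (tail i) (head i) % d) {ys = upTo d} xs! inj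
          (λ {i} _ → ∈-upTo⁺ (m%n<n (rank (tail i) (head i)) d)))
        (≤-reflexive (length-upTo d))
        where
        inj : ∀ {i j} → i ∈ xs → j ∈ xs →
          rank (tail i) (head i) % d ≡ rank (tail j) (head j) % d → i ≡ j
        inj {i} {j} p q eq = arc-ext t≡ (rank-injective (subst (λ u → D u (head i) ≡ true) t≡ (is-arc i)) (is-arc j)
          (trans (cong (λ u → rank u (head i)) (sym t≡)) ranks))
          where
          t≡ : tail i ≡ tail j
          t≡ = cong proj₁ (star p q)
          ranks : rank (tail i) (head i) ≡ rank (tail j) (head j)
          ranks = trans (m≡m%n+[m/n]*n (rank (tail i) (head i)) d)
            (trans (cong₂ (λ a b → a + b * d) eq (cong proj₂ (star p q)))
              (sym (m≡m%n+[m/n]*n (rank (tail j) (head j)) d)))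

      head-degree : DegreeBound head d
      head-degree {[]} _ _ = z≤n
      head-degree {xs@(x ∷ _)} xs! star = ≤-trans
        (length-inj tail xs! (λ p q t → arc-ext t (star p q))
          (λ {i} p → ∈-trues⁺ {p = λ u → D u (head x)} (subst (λ v → D (tail i) v ≡ true) (star p (here refl)) (is-arc i))))
        (≤-trans (≤-reflexive (sym (countV≡length-trues (λ u → D u (head x))))) (in-deg (head x)))

      colouring : ∃ λ (c : Fin (length arcs) → Fin d) → Proper copy c × Proper head c
      colouring = bipartite-edge-colouring (≡-dec _≟ᶠ_ _≟_) _≟ᶠ_ copy-degree head-degree

      arcColour : Fin n → Fin n → Maybe (Fin d)
      arcColour u v with any? (≡-dec _≟ᶠ_ _≟ᶠ_ (u , v)) arcs
      ... | yes p = just (proj₁ colouring (index p))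
      ... | no _ = nothing

      arcColour-view : ∀ {u v} → D u v ≡ true →
        ∃ λ i → (u , v) ≡ lookup arcs i × arcColour u v ≡ just (proj₁ colouring i)
      arcColour-view {u} {v} arc with any? (≡-dec _≟ᶠ_ _≟ᶠ_ (u , v)) arcs
      ... | yes p = index p , lookup-index p , refl
      ... | no ¬p = contradiction
              (∈-filter⁺ isArc? (∈-cartesianProduct⁺ (∈-allFin u) (∈-allFin v)) arc) ¬p

    splitting-suc : Splitting D k d
    splitting-suc = record
      { colour = arcColour
      ; total = λ arc → let i , _ , eq = arcColour-view arc in _ , eq
      ; in-unique = in-unique
      ; out-bound = out-bound
      }
      where
      in-unique : ∀ {i u u′ v} → Coloured D arcColour i u v → Coloured D arcColour i u′ v → u ≡ u′
      in-unique (arc , c) (arc′ , c′)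
        with i , refl , e ← arcColour-view arc | j , eq′ , e′ ← arcColour-view arc′ =
        trans (cong tail (proj₂ (proj₂ colouring)
          (just-injective (trans (sym e) (trans c (trans (sym c′) e′)))) (cong proj₂ eq′)))
          (sym (cong proj₁ eq′))
      -- Arcs of one colour leave different copies of `u`, and ranks below `k u * d` give only `k u`
      -- copies.
      out-bound : ∀ {i u xs} → Unique xs → (∀ {v} → v ∈ xs → Coloured D arcColour i u v) → length xs ≤ k u
      out-bound {i} {u} {xs} xs! col = ≤-trans
        (length-inj (λ v → rank u v / d) {ys = upTo (k u)} xs! inj
          (λ v∈ → ∈-upTo⁺ (m<n*o⇒m/o<n (≤-trans (rank<outdeg (proj₁ (col v∈))) (out-deg u)))))
        (≤-reflexive (length-upTo (k u)))
        where
        inj : ∀ {v w} → v ∈ xs → w ∈ xs → rank u v / d ≡ rank u w / d → v ≡ w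
        inj v∈ w∈ eq with arc , c ← col v∈ | arc′ , c′ ← col w∈
          with i , refl , e ← arcColour-view arc | j , eq′ , e′ ← arcColour-view arc′ =
          trans (cong head (proj₁ (proj₂ colouring)
            (just-injective (trans (sym e) (trans c (trans (sym c′) e′))))
            (cong₂ _,_ (cong proj₁ eq′) (trans eq (cong (λ (t , h) → rank t h / d) eq′)))))
            (sym (cong proj₂ eq′))

splitting : ∀ {n} (D : Digraph n) (k : Fin n → ℕ) (d : ℕ) → (∀ v → indeg D v ≤ d) →
  (∀ v → outdeg D v ≤ k v * d) → Splitting D k d
splitting D k zero in-deg out-deg = record
  { colour = λ _ _ → nothing
  ; total = λ {u} {v} arc → contradiction
      (≤-trans (length≤countV {p = λ u → D u v} {xs = u ∷ []} (All.[] ∷ []) λ { (here refl) → arc })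
        (in-deg v)) λ ()
  ; in-unique = λ { {()} }
  ; out-bound = λ { {()} }
  }
splitting D k (suc d-1) in-deg out-deg = splitting-suc D k d-1 in-deg out-deg

-- On a finite vertex set this amounts to having no directed cycle.
NoClosedSet : ∀ {n} → Digraph n → Set₁
NoClosedSet {n} B = (P : Fin n → Set) → (∀ {v} → P v → ∃ λ u → P u × B u v ≡ true) → ∀ {v} → ¬ P v

-- With indegrees at most 1 the direction of the closing arc propagates around an undirected cycle,
-- so its vertices form a closed set.
forest : ∀ {n} {B : Digraph n} → (∀ {u u′ v} → B u v ≡ true → B u′ v ≡ true → u ≡ u′) →
  NoClosedSet B → IsForest B
forest {B = B} in-unique acyclic (inj₁ (u , v , _ , uv , vu)) =
  acyclic (λ x → x ≡ u ⊎ x ≡ v)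
    (λ { (inj₁ refl) → v , inj₂ refl , vu ; (inj₂ refl) → u , inj₁ refl , uv }) (inj₁ refl)
forest {B = B} in-unique acyclic (inj₂ (k , vs , vs-inj , adj , wrap)) =
  acyclic (λ x → ∃ λ j → vs j ≡ x)
    (λ { (j , refl) → let j′ , b = preds wrap j in vs j′ , (j′ , refl) , b }) (zero , refl)
  where
  -- The inequality says that the predecessor found is not the next vertex of the traversal; as
  -- predecessors are unique, the next arc must point onward.
  forward backward : Fin (suc (suc (suc k))) → Set
  forward j = ∃ λ j′ → B (vs j′) (vs j) ≡ true × toℕ j′ ≢ suc (toℕ j)
  backward j = ∃ λ j′ → B (vs j′) (vs j) ≡ true × suc (toℕ j′) ≢ toℕ j

  forward-step : ∀ i → forward (inject₁ i) → forward (suc i)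
  forward-step i (j′ , b , ≢) with adj i
  ... | inj₁ b′ = inject₁ i , b′ , λ eq → <⇒≢ (m≤n⇒m≤1+n ≤-refl) (trans (sym (toℕ-inject₁ i)) eq)
  ... | inj₂ b′ = contradiction
    (trans (cong toℕ (vs-inj (in-unique b b′))) (cong suc (sym (toℕ-inject₁ i)))) ≢

  backward-step : ∀ i → backward (suc i) → backward (inject₁ i)
  backward-step i (j′ , b , ≢) with adj i
  ... | inj₂ b′ = suc i , b′ , λ eq → <⇒≢ (m≤n⇒m≤1+n ≤-refl) (sym (trans eq (toℕ-inject₁ i)))
  ... | inj₁ b′ = contradiction
    (cong suc (trans (cong toℕ (vs-inj (in-unique b b′))) (toℕ-inject₁ i))) ≢

  preds : Adj B (vs (fromℕ (suc (suc k)))) (vs zero) → ∀ j → ∃ λ j′ → B (vs j′) (vs j) ≡ true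
  preds (inj₁ b) j = let j′ , b′ , _ = <-weakInduction forward (fromℕ _ , b , λ ()) forward-step j in j′ , b′
  preds (inj₂ b) j = let j′ , b′ , _ = >-weakInduction backward (zero , b , λ ()) backward-step j in j′ , b′

branching : ∀ {n} {f : Fin n → ℕ} {B : Digraph n} →
  (∀ {u u′ v} → B u v ≡ true → B u′ v ≡ true → u ≡ u′) → NoClosedSet B →
  (∀ v → outdeg B v ≤ f v ∸ 1) → IsDegreeFBranching f B
branching {B = B} in-unique acyclic out =
  (λ v → countV≤1 (λ u → B u v) in-unique) , forest in-unique acyclic , out

ColourClass⁻ : ∀ {n m} {D : Digraph n} {c : Fin n → Fin n → Fin m} {i u v} →
  ColourClass D c i u v ≡ true → D u v ≡ true × c u v ≡ i
ColourClass⁻ {D = D} {c} {i} {u} {v} eq with D u v | c u v ≟ᶠ i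
... | true | yes p = refl , p
... | true | no _ = contradiction eq λ ()
... | false | _ = contradiction eq λ ()

module _ {n} (f : Fin n → Fin n) {v} (per : Periodic f v) where

  -- A fixed iterate still leads back to `v` by periodicity, so it would be `v` itself.
  fold-moves : f v ≢ v → ∀ k → f (fold v f k) ≢ fold v f k
  fold-moves moves k fixed with j , eq ← Periodic-sym f per (k , refl) =
    moves (subst (λ w → f w ≡ w) (trans (sym (stays j)) eq) fixed)
    where
    stays : ∀ j → fold (fold v f k) f j ≡ fold v f k
    stays zero = refl
    stays (suc j) = trans (cong f (stays j)) fixed

  period : ∃ λ p → fold v f (suc p) ≡ v × (∀ {q} → q < p → fold v f (suc q) ≢ v)
  period = least (λ k → fold v f (suc k) ≟ᶠ v) (proj₁ per)
    (trans (fold-suc f v (proj₁ per)) (proj₂ per))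

  private
    p : ℕ
    p = proj₁ period

    -- A coincidence within the least period, pushed forward, would give an earlier return to `v`.
    no-return : ∀ {k l} → k < l → l < suc p → fold v f k ≢ fold v f l
    no-return {k} {l} k<l l<p eq
      with r , l+r ← m≤n⇒∃[o]m+o≡n (≤-pred l<p) =
      proj₂ (proj₂ period) {r + k} (≤-trans (+-monoʳ-< r k<l) (≤-reflexive (trans (+-comm r l) l+r))) (begin
        fold v f (suc r + k)         ≡⟨ fold-+ v f (suc r) ⟩
        fold (fold v f k) f (suc r)  ≡⟨ cong (λ z → fold z f (suc r)) eq ⟩
        fold (fold v f l) f (suc r)  ≡⟨ fold-+ v f (suc r) ⟨
        fold v f (suc r + l)         ≡⟨ cong (fold v f ∘ suc) (trans (+-comm r l) l+r) ⟩
        fold v f (suc p)             ≡⟨ proj₁ (proj₂ period) ⟩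
        v                            ∎)
      where open ≡-Reasoning

  fold-injective : ∀ {k l} → k < suc p → l < suc p → fold v f k ≡ fold v f l → k ≡ l
  fold-injective {k} {l} k< l< eq with <-cmp k l
  ... | tri< lt _ _ = contradiction eq (no-return lt l<)
  ... | tri≈ _ k≡l _ = k≡l
  ... | tri> _ _ gt = contradiction (sym eq) (no-return gt k<)

-- Moving one arc of each monochromatic cycle

module Recolouring {n} {D : Digraph n} (loopless : Loopless D) {k : Fin n → ℕ} {d : ℕ}
  (S : Splitting D k d) (girth : DirGirth≥ D (4 * d)) where

  open Splitting S

  private
    coloured? : ∀ i v → Decidable (λ u → Coloured D colour i u v)
    coloured? i v u = (D u v ≟ᵇ true) ×-dec (≡-decᵐ _≟ᶠ_ (colour u v) (just i))

  -- parent i v is v itself when no arc of colour i enters v.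
  parent : Fin d → Fin n → Fin n
  parent i v with Fin.any? (coloured? i v)
  ... | yes (u , _) = u
  ... | no _ = v

  parent-coloured : ∀ {i v} → parent i v ≢ v → Coloured D colour i (parent i v) v
  parent-coloured {i} {v} moves with Fin.any? (coloured? i v)
  ... | yes (_ , c) = c
  ... | no _ = contradiction refl moves

  parent-unique : ∀ {i u v} → Coloured D colour i u v → parent i v ≡ u
  parent-unique {i} {u} {v} c with Fin.any? (coloured? i v)
  ... | yes (_ , c′) = in-unique c′ c
  ... | no ¬c = contradiction (u , c) ¬c

  -- The pair (i , v) stands for the arc of colour i entering v.
  Item : Set
  Item = Fin d × Fin n

  source : Item → Fin n
  source (i , v) = parent i v

  OnCycle : Item → Set
  OnCycle (i , v) = parent i v ≢ v × Periodic (parent i) v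

  onCycle? : Decidable OnCycle
  onCycle? (i , v) = ¬? (parent i v ≟ᶠ v) ×-dec reach? (parent i) (parent i v) v

  items : List Item
  items = filter onCycle? (cartesianProduct (allFin d) (allFin n))

  items! : Unique items
  items! = filter⁺ onCycle? (cartesianProduct⁺ (allFin⁺ d) (allFin⁺ n))

  ∈-items⁺ : ∀ {e} → OnCycle e → e ∈ items
  ∈-items⁺ {i , v} = ∈-filter⁺ onCycle? (∈-cartesianProduct⁺ (∈-allFin i) (∈-allFin v))

  ∈-items⁻ : ∀ {e} → e ∈ items → OnCycle e
  ∈-items⁻ = proj₂ ∘ ∈-filter⁻ onCycle? {xs = cartesianProduct (allFin d) (allFin n)}

  record _~_ (a b : Item) : Set where
    constructor same
    field
      colour-≡ : proj₁ a ≡ proj₁ b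
      reaches : Reach (parent (proj₁ a)) (proj₂ a) (proj₂ b)

  _~?_ : Binary.Decidable _~_
  (i , v) ~? (j , w) = map′ (λ (p , q) → same p q) (λ (same p q) → p , q)
    ((i ≟ᶠ j) ×-dec reach? (parent i) v w)

  ~-refl : ∀ {a} → a ~ a
  ~-refl = same refl (0 , refl)

  ~-trans : ∀ {a b c} → a ~ b → b ~ c → a ~ c
  ~-trans {i , _} (same refl p) (same refl q) = same refl (Reach-trans (parent i) p q)

  -- Reachability along `parent` can be reversed on cycles, whence the membership hypothesis.
  ~-sym : ∀ {a b} → a ∈ items → a ~ b → b ~ a
  ~-sym {i , _} a∈ (same refl p) = same refl (Periodic-sym (parent i) (proj₂ (∈-items⁻ a∈)) p)

  no-loop : ∀ {e} → e ∈ items → proj₂ e ≢ source e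
  no-loop e∈ eq = proj₁ (∈-items⁻ e∈) (sym eq)

  simple : ∀ {a b} → a ∈ items → b ∈ items → proj₂ a ≡ proj₂ b → source a ≡ source b → a ≡ b
  simple {i , v} {j , v} a∈ b∈ refl eq =
    cong (_, v) (just-injective (trans (sym (proj₂ (parent-coloured (proj₁ (∈-items⁻ a∈)))))
      (trans (cong (λ u → colour u v) eq) (proj₂ (parent-coloured (proj₁ (∈-items⁻ b∈)))))))

  fibre-length : ∀ {xs : List Item} → Unique xs →
    (∀ {a b} → a ∈ xs → b ∈ xs → proj₁ a ≡ proj₁ b → a ≡ b) → length xs ≤ d
  fibre-length xs! inj = ≤-trans (length-inj proj₁ xs! inj (λ _ → ∈-allFin _))
    (≤-reflexive (length-tabulate id))

  head-degree : ∀ v → length (filter (λ e → proj₂ e ≟ᶠ v) items) ≤ d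
  head-degree v = fibre-length (filter⁺ P? items!) inj
    where
    P? : Decidable (λ (e : Item) → proj₂ e ≡ v)
    P? e = proj₂ e ≟ᶠ v
    inj : ∀ {a b} → a ∈ filter P? items → b ∈ filter P? items → proj₁ a ≡ proj₁ b → a ≡ b
    inj p q eq = cong₂ _,_ eq
      (trans (proj₂ (∈-filter⁻ P? {xs = items} p)) (sym (proj₂ (∈-filter⁻ P? {xs = items} q))))

  -- A vertex may have many out-arcs of one colour, but only one of them lies on a cycle of that
  -- colour, because `parent i` is injective on periodic vertices.
  tail-degree : ∀ u → length (filter (λ e → source e ≟ᶠ u) items) ≤ d
  tail-degree u = fibre-length (filter⁺ P? items!) inj
    where
    P? : Decidable (λ e → source e ≡ u)
    P? e = source e ≟ᶠ u
    inj : ∀ {a b} → a ∈ filter P? items → b ∈ filter P? items → proj₁ a ≡ proj₁ b → a ≡ b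
    inj {i , v} {i , w} p q refl
      with a∈ , s ← ∈-filter⁻ P? {xs = items} p with b∈ , s′ ← ∈-filter⁻ P? {xs = items} q =
      cong (i ,_) (Periodic-injective (parent i) (proj₂ (∈-items⁻ a∈)) (proj₂ (∈-items⁻ b∈))
        (trans s (sym s′)))

  module _ {i : Fin d} {v : Fin n} (moves : parent i v ≢ v) (per : Periodic (parent i) v) where

    private
      f : Fin n → Fin n
      f = parent i

      p : ℕ
      p = proj₁ (period f per)

    orbit-onCycle : ∀ j → OnCycle (i , fold v f j)
    orbit-onCycle j = fold-moves f per moves j , Periodic-fold f j per

    period≥4d : 4 * d ≤ suc p
    -- `parent` runs against the arcs, so the orbit is listed in reverse to obtain a directed cycle
    -- of length `suc p`.
    period≥4d = girth p (λ j → fold v f (p ∸ toℕ j)) (inj , step , last)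
      where
      arc : ∀ j → D (fold v f (suc j)) (fold v f j) ≡ true
      arc j = proj₁ (parent-coloured (proj₁ (orbit-onCycle j)))
      inj : ∀ {j l : Fin (suc p)} → fold v f (p ∸ toℕ j) ≡ fold v f (p ∸ toℕ l) → j ≡ l
      inj {j} {l} eq = toℕ-injective (∸-cancelˡ-≡ (toℕ≤pred[n] j) (toℕ≤pred[n] l)
        (fold-injective f per (s≤s (m∸n≤m p (toℕ j))) (s≤s (m∸n≤m p (toℕ l))) eq))
      step : ∀ (j : Fin p) → D (fold v f (p ∸ toℕ (inject₁ j))) (fold v f (p ∸ suc (toℕ j))) ≡ true
      step j = subst (λ e → D (fold v f e) (fold v f (p ∸ suc (toℕ j))) ≡ true)
        (trans (sym (+-∸-assoc 1 (toℕ<n j))) (cong (p ∸_) (sym (toℕ-inject₁ j))))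
        (arc (p ∸ suc (toℕ j)))
      last : D (fold v f (p ∸ toℕ (fromℕ p))) (fold v f p) ≡ true
      last = subst (λ u → D u (fold v f p) ≡ true)
        (trans (proj₁ (proj₂ (period f per)))
          (cong (fold v f) (sym (trans (cong (p ∸_) (toℕ-fromℕ p)) (n∸n≡0 p)))))
        (arc p)

    orbit-large : 4 * d ≤ length (filter (_~? (i , v)) items)
    orbit-large = ≤-trans period≥4d (≤-trans (≤-reflexive (sym (length-upTo (suc p))))
      (length-inj (λ j → i , fold v f j) (upTo⁺ (suc p))
        (λ j∈ l∈ eq → fold-injective f per (∈-upTo⁻ j∈) (∈-upTo⁻ l∈) (cong proj₂ eq))
        (λ {j} _ → ∈-filter⁺ (_~? (i , v)) (∈-items⁺ (orbit-onCycle j))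
          (same refl (Periodic-sym f per (j , refl))))))

  class-large : ∀ {e} → e ∈ items → 4 * d ≤ length (filter (_~? e) items)
  class-large {i , v} e∈ with moves , per ← ∈-items⁻ e∈ = orbit-large moves per

  -- Edges run backwards here, from the head of an arc to its tail.
  open Exchange _≟ᶠ_ (≡-dec _≟ᶠ_ _≟ᶠ_) proj₂ source _~_ _~?_ items items!
    ~-refl ~-trans ~-sym no-loop simple d head-degree tail-degree class-large

  open Selection

  private
    M : Selection
    M = proj₁ transversal

  Picked : Fin n → Fin n → Set
  Picked u v = ∃ λ i → In M (i , v) × parent i v ≡ u

  picked? : Binary.Decidable Picked
  picked? u v = Fin.any? (λ i → in? M (i , v) ×-dec (parent i v ≟ᶠ u))

  newColour : Fin n → Fin n → Fin (suc d)
  newColour u v with picked? u v | colour u v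
  ... | yes _ | _ = fromℕ d
  ... | no _ | just i = inject₁ i
  -- A default value: by `total` such a pair is not an arc.
  ... | no _ | nothing = fromℕ d

  Kept : Fin d → Fin n → Fin n → Set
  Kept i u v = ColourClass D newColour (inject₁ i) u v ≡ true

  kept-coloured : ∀ {i u v} → Kept i u v → Coloured D colour i u v × ¬ Picked u v
  kept-coloured {i} {u} {v} eq with ColourClass⁻ {D = D} {c = newColour} eq
  ... | arc , new with picked? u v | colour u v
  ...   | yes _ | _ = contradiction new fromℕ≢inject₁
  ...   | no ¬p | just j = (arc , cong just (inject₁-injective new)) , ¬p
  ...   | no _ | nothing = contradiction new fromℕ≢inject₁

  moved-picked : ∀ {u v} → ColourClass D newColour (fromℕ d) u v ≡ true → Picked u v
  moved-picked {u} {v} eq with ColourClass⁻ {D = D} {c = newColour} eq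
  ... | arc , new with picked? u v | colour u v | total arc
  ...   | yes p | _ | _ = p
  ...   | no _ | just j | _ = contradiction (sym new) fromℕ≢inject₁
  ...   | no _ | nothing | _ , ()

  -- In a closed set `parent i` can be iterated until a cycle of colour `i` is reached. The set
  -- contains the whole cycle, including the head of its picked arc, which was not kept.
  kept-acyclic : ∀ i → NoClosedSet (ColourClass D newColour (inject₁ i))
  kept-acyclic i P closed {v} pv = periodic-free (proj₂ (eventually-periodic (parent i) v))
    (fold-closed (proj₁ (eventually-periodic (parent i) v)) pv)
    where
    entering : ∀ {w} → P w → Kept i (parent i w) w × P (parent i w)
    entering {w} pw with u , pu , b ← closed pw =
      subst (λ u → Kept i u w × P u) (sym (parent-unique (proj₁ (kept-coloured b)))) (b , pu)
    fold-closed : ∀ {w} k → P w → P (fold w (parent i) k)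
    fold-closed zero pw = pw
    fold-closed (suc k) pw = proj₂ (entering (fold-closed k pw))
    moves : ∀ {w} → P w → parent i w ≢ w
    moves {w} pw eq = contradiction
      (trans (sym (loopless w)) (subst (λ u → D u w ≡ true) eq
        (proj₁ (proj₁ (kept-coloured (proj₁ (entering pw))))))) λ ()
    periodic-free : ∀ {w} → Periodic (parent i) w → ¬ P w
    periodic-free {w} per pw
      with (j , w′) , m , same refl w′↝w ← proj₂ transversal (∈-items⁺ {i , w} (moves pw , per))
      with l , refl ← Periodic-sym (parent i) (proj₂ (∈-items⁻ (In⊆items M m))) w′↝w =
      proj₂ (kept-coloured (proj₁ (entering (fold-closed l pw)))) (i , m , refl)

  moved-acyclic : NoClosedSet (ColourClass D newColour (fromℕ d))
  moved-acyclic P closed {v} = go (wf M v)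
    where
    go : ∀ {v} → Acc (Arc (In M)) v → ¬ P v
    go (acc rs) pv with u , pu , b ← closed pv with i , m , eq ← moved-picked b =
      go (rs ((i , _) , m , refl , eq)) pu

  newColour-branching : ∀ (f : Fin n → ℕ) → (∀ v → 1 ≤ f v ∸ 1) → (∀ v → k v ≤ f v ∸ 1) →
    ∀ i → IsDegreeFBranching f (ColourClass D newColour i)
  newColour-branching f 1≤ k≤ i with view i
  ... | ‵inject₁ j = branching {f = f}
    (λ b b′ → in-unique (proj₁ (kept-coloured b)) (proj₁ (kept-coloured b′)))
    (kept-acyclic j)
    (λ u → countV≤ _ λ xs! all → ≤-trans (out-bound xs! (proj₁ ∘ kept-coloured ∘ all)) (k≤ u))
  ... | ‵fromℕ = branching {f = f} in-unique′ moved-acyclic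
    (λ u → ≤-trans (countV≤1 _ out-unique′) (1≤ u))
    where
    in-unique′ : ∀ {u u′ v} → ColourClass D newColour (fromℕ d) u v ≡ true →
      ColourClass D newColour (fromℕ d) u′ v ≡ true → u ≡ u′
    in-unique′ b b′ with i , m , refl ← moved-picked b with j , m′ , refl ← moved-picked b′ =
      cong source (src-inj M m m′ refl)
    out-unique′ : ∀ {u v v′} → ColourClass D newColour (fromℕ d) u v ≡ true →
      ColourClass D newColour (fromℕ d) u v′ ≡ true → v ≡ v′
    out-unique′ b b′ with i , m , refl ← moved-picked b with j , m′ , eq ← moved-picked b′ =
      cong proj₂ (tgt-inj M m m′ (sym eq))

theorem17 : (n : ℕ) (D : Digraph n) → Loopless D →
    (f : Fin n → ℕ) → ((v : Fin n) → 2 ≤ f v) →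
    DirGirth≥ D (4 * (Δ⁻ D ⊔ Δ⁺[f-1] D f)) →
    DirDegFArboricity≤ D f (suc (Δ⁻ D ⊔ Δ⁺[f-1] D f))
theorem17 n D loopless f 2≤f girth =
  newColour , newColour-branching f (λ v → ∸-monoˡ-≤ 1 (2≤f v)) (λ _ → ≤-refl)
  where
  d : ℕ
  d = Δ⁻ D ⊔ Δ⁺[f-1] D f
  in-deg : ∀ v → indeg D v ≤ d
  in-deg v = ≤-trans (maxV-upper (indeg D) v) (m≤m⊔n _ _)
  out-deg : ∀ v → outdeg D v ≤ (f v ∸ 1) * d
  out-deg v = ≤-trans
    (ceilDivSuc≤⇒ (outdeg D v) (f v ∸ 2)
      (≤-trans (maxV-upper (λ v → ceilDivSuc (outdeg D v) (f v ∸ 2)) v) (m≤n⊔m (Δ⁻ D) _)))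
    -- `suc (f v ∸ 2)` equals `f v ∸ 1` because `f v` is at least 2.
    (≤-reflexive (cong (_* d) (sym (+-∸-assoc 1 (2≤f v)))))
  open Recolouring loopless (splitting D (λ v → f v ∸ 1) d in-deg out-deg) girth
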